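{- Let $k \geq 2$ be an integer. If either Max moves first and $k$ is even, or Mini moves first and $k$ is odd, then $s(n, \mathcal{M}_k) \geq n-1$. In all other cases (Max moves first and $k$ is odd, or Mini moves first and $k$ is even), $s(n, \mathcal{M}_k) \leq \binom{2k-1}{2}$.
   Context: Let $\mathcal{P}$ be a monotone increasing property of graphs on vertex set $[n]$. An edge $e \in \binom{[n]}{2}\setminus E(G)$ is legal with respect to a graph $G \notin \mathcal{P}$ if $G \cup \{e\} \notin \mathcal{P}$. The saturation game $(n,\mathcal{P})$: starting from the empty graph on $[n]$, two players, Mini and Max, alternately add a legal edge to the current graph $G$. The game ends when no legal edge exists. Max wants to maximize the number of edges of the final graph and Mini wants to minimize it. The score $s(n,\mathcal{P})$ is the number of edges of the final graph under optimal play by both players; it may depend on which player moves first. $\mathcal{M}_k$ denotes the property of admitting a matching of size $k$. -}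

module Defs where

open import Data.Nat using (ℕ; _+_)
import Data.Nat
open import Data.Fin using (Fin) renaming (_<_ to _<ᶠ_)
open import Data.Product using (_×_; _,_; ∃)
open import Data.List using (List; []; _∷_; length)
open import Data.List.Membership.Propositional using (_∈_; _∉_)
open import Data.List.Relation.Unary.All using (All)
open import Data.List.Relation.Unary.AllPairs using (AllPairs)
open import Relation.Nullary using (¬_)
open import Relation.Binary.PropositionalEquality using (_≡_; _≢_)

-- A (potential) edge on vertex set Fin n, written as an ordered pair (i , j);
-- only pairs with i < j are ever added, so each unordered pair {i,j} has
-- exactly one representative.
Edge : ℕ → Set
Edge n = Fin n × Fin n

-- A graph on vertex set Fin n is given by the list of its edges
-- (the edges added so far in the game; they are distinct, i < j).
Graph : ℕ → Set
Graph n = List (Edge n)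

∣E∣ : ∀ {n} → Graph n → ℕ
∣E∣ G = length G

Disjoint : ∀ {n} → Edge n → Edge n → Set
Disjoint (a , b) (c , d) = (a ≢ c) × (a ≢ d) × (b ≢ c) × (b ≢ d)

IsMatchingOfSize : ∀ {n} → ℕ → Graph n → List (Edge n) → Set
IsMatchingOfSize k G M = (length M ≡ k) × All (_∈ G) M × AllPairs Disjoint M

HasMatching : ∀ {n} → ℕ → Graph n → Set
HasMatching k G = ∃ λ M → IsMatchingOfSize k G M

Legal : ∀ {n} → ℕ → Graph n → Edge n → Set
Legal k G (i , j) = (i <ᶠ j) × ((i , j) ∉ G) × ¬ HasMatching k ((i , j) ∷ G)

Terminal : ∀ {n} → ℕ → Graph n → Set
Terminal {n} k G = (e : Edge n) → ¬ Legal k G e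

data Player : Set where
  Max Mini : Player

-- MaxForces k t p G : in the saturation game (n, 𝓜_k) from position G with
-- player p to move, Max has a strategy guaranteeing that the final graph has
-- at least t edges (whatever Mini does).  By determinacy of finite games,
-- this holds from the empty graph iff the score s(n,𝓜_k) ≥ t.
data MaxForces {n : ℕ} (k t : ℕ) : Player → Graph n → Set where
  done     : ∀ {p G} → Terminal k G → t Data.Nat.≤ ∣E∣ G → MaxForces k t p G
  maxMove  : ∀ {G} (e : Edge n) → Legal k G e → MaxForces k t Mini (e ∷ G)
           → MaxForces k t Max G
  miniMove : ∀ {G} → ¬ Terminal k G
           → ((e : Edge n) → Legal k G e → MaxForces k t Max (e ∷ G))
           → MaxForces k t Mini G

-- MiniForces k t p G : Mini can guarantee the final graph has at most t edges.
-- From the empty graph this holds iff s(n,𝓜_k) ≤ t.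
data MiniForces {n : ℕ} (k t : ℕ) : Player → Graph n → Set where
  done     : ∀ {p G} → Terminal k G → ∣E∣ G Data.Nat.≤ t → MiniForces k t p G
  miniMove : ∀ {G} (e : Edge n) → Legal k G e → MiniForces k t Max (e ∷ G)
           → MiniForces k t Mini G
  maxMove  : ∀ {G} → ¬ Terminal k G
           → ((e : Edge n) → Legal k G e → MiniForces k t Mini (e ∷ G))
           → MiniForces k t Max G

ScoreAtLeast : (n k : ℕ) → Player → ℕ → Set
ScoreAtLeast n k first t = MaxForces {n} k t first []

ScoreAtMost : (n k : ℕ) → Player → ℕ → Set
ScoreAtMost n k first t = MiniForces {n} k t first []

{-# OPTIONS --safe #-}
module Submission where

-- Both strategies rest on two facts: a complete graph on m vertices has ⌊m/2⌋ edges modulo 2, and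
-- the parity of the number of edges tells whose turn it is.  Both are for n ≥ 2k; for n < 2k no
-- k-matching fits and every play ends in the complete graph.
--
-- Max keeps the set X of touched vertices perfectly matched, enlarging it by two at a time until
-- ∣X∣ = 2k − 2, and from then on plays inside X.  By parity it is Mini who has to leave X first, by an
-- edge c d with c ∈ X; Max answers with c w for a new w.  Now c has three private neighbours (d, w and
-- its partner) outside a (k − 2)-matching, so every edge at c stays legal for the rest of the game,
-- and the final graph contains a spanning star.
--
-- Mini keeps every component either factor-critical or "linkable", a property of even components
-- (a cycle of factor-critical pieces is the model case) which ensures that whenever Max joins a
-- linkable component to another one, a second edge between the two makes their union factor-critical
-- or linkable again.  If Max does not do so, Mini plays inside a component; if all of
-- them are complete, then by parity the matching number is at most k − 2 and Mini may join two
-- factor-critical components into a linkable one.  Throughout, the matching number is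
-- ν = Σ ⌊∣component∣/2⌋ ≤ k − 1, so there are at most (2ν + 1 choose 2) edges.

open import Defs
open import Data.Empty using (⊥; ⊥-elim)
open import Data.Fin using (Fin) renaming (_<_ to _<ᶠ_)
open import Data.Fin.Properties using (any?; _≟_) renaming (_<?_ to _<ᶠ?_; <-cmp to <ᶠ-cmp; <-irrefl to <ᶠ-irrefl; <-asym to <ᶠ-asym)
open import Data.List using (List; []; _∷_; [_]; _++_; length; map; concat; allFin)
open import Data.List.Membership.Propositional using (_∈_; _∉_; find; lose)
open import Data.List.Membership.Propositional.Properties using (∈-∃++; ∈-++⁻; ∈-++⁺ˡ; ∈-++⁺ʳ; ∈-map⁺; ∈-map⁻; ∈-allFin; ∈-concat⁻′)
import Data.List.Membership.DecPropositional as DecMembership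
open import Data.List.Properties using (length-++; length-map; length-tabulate; ++-assoc; concat-map-[_])
open import Data.List.Relation.Binary.Permutation.Propositional as ↭ using (_↭_; refl; prep; swap; ↭-refl; ↭-sym; ↭-trans; ↭-prep; ↭-swap; ↭-reflexive; ↭⇒↭ₛ)
open import Data.List.Relation.Binary.Permutation.Propositional.Properties using (∈-resp-↭; All-resp-↭; Any-resp-↭; ↭-length; ↭-empty-inv; shift; shifts; ++⁺; ++⁺ˡ; ++-comm)
import Data.List.Relation.Binary.Permutation.Setoid.Properties as PermSetoid
open import Data.List.Relation.Binary.Subset.Propositional using (_⊆_)
open import Data.List.Relation.Unary.All as All using (All; []; _∷_)
open import Data.List.Relation.Unary.All.Properties using (¬Any⇒All¬; All¬⇒¬Any; ¬All⇒Any¬)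
open import Data.List.Relation.Unary.AllPairs using (AllPairs; []; _∷_)
open import Data.List.Relation.Unary.Any using (Any; here; there) renaming (any? to anyL?)
open import Data.List.Relation.Unary.Unique.Propositional using (Unique)
import Data.List.Relation.Unary.Unique.Propositional.Properties as Uniqueₚ
open import Data.Nat using (ℕ; zero; suc; _+_; _*_; _∸_; _≤_; _<_; z≤n; s≤s; s≤s⁻¹; ⌊_/2⌋)
open import Data.Nat.Combinatorics using (_C_; nCk+nC[k+1]≡[n+1]C[k+1]; nC1≡n)
open import Data.Nat.Divisibility using (_∣_; divides; ∣m∣n⇒∣m+n; ∣m+n∣m⇒∣n)
open import Data.Nat.Properties as ℕ using (≤-trans; ≤-refl; ≤-reflexive; ≤-antisym; ≤∧≢⇒<; <⇒≤; <⇒≱; ≰⇒>; _≤?_; n≤1+n; 1+n≰n; n≢0⇒n>0; m≤m+n; m≤n⇒m<n∨m≡n; suc-injective; +-suc; +-comm; +-assoc; +-identityʳ; +-mono-≤; +-cancelˡ-≤; ⌊n/2⌋-mono; n≡⌊n+n/2⌋; n≡⌈n+n/2⌉; module ≤-Reasoning)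
open import Data.Nat.Tactic.RingSolver using (solve-∀)
open import Data.Product using (_×_; _,_; ∃; ∃₂; proj₁; proj₂)
open import Data.Product.Properties using (≡-dec)
open import Data.Sum using (_⊎_; inj₁; inj₂; [_,_]′) renaming (map to map-⊎)
open import Data.Unit using (⊤; tt)
open import Relation.Binary.Definitions using (DecidableEquality; Symmetric; tri<; tri≈; tri>)
open import Relation.Binary.PropositionalEquality using (_≡_; _≢_; refl; sym; trans; cong; cong₂; subst; subst₂; setoid)
open import Relation.Nullary using (¬_; Dec; yes; no)
open import Relation.Nullary.Decidable using (_×-dec_; ¬?; map′; decidable-stable)


-- Lists without repetitions, up to permutation

module _ {A : Set} where

  Unique-resp-↭ : {xs ys : List A} → xs ↭ ys → Unique xs → Unique ys
  Unique-resp-↭ π = PermSetoid.Unique-resp-↭ (setoid A) (↭⇒↭ₛ π)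

  ∷-unique : ∀ {x} {xs : List A} → x ∉ xs → Unique xs → Unique (x ∷ xs)
  ∷-unique x∉ u = ¬Any⇒All¬ _ x∉ ∷ u

  unique-head : ∀ {x} {xs : List A} → Unique (x ∷ xs) → x ∉ xs
  unique-head (x∉ ∷ _) = All¬⇒¬Any x∉

  unique-tail : ∀ {x} {xs : List A} → Unique (x ∷ xs) → Unique xs
  unique-tail (_ ∷ u) = u

  unique-++ˡ : ∀ (xs : List A) {ys} → Unique (xs ++ ys) → Unique xs
  unique-++ˡ []       _ = []
  unique-++ˡ (x ∷ xs) u =
    ∷-unique (λ x∈ → unique-head u (∈-++⁺ˡ x∈)) (unique-++ˡ xs (unique-tail u))

  unique-++ʳ : ∀ (xs : List A) {ys} → Unique (xs ++ ys) → Unique ys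
  unique-++ʳ []       u = u
  unique-++ʳ (x ∷ xs) u = unique-++ʳ xs (unique-tail u)

  unique-++-disjoint : ∀ (xs : List A) {ys x} → Unique (xs ++ ys) → x ∈ xs → x ∉ ys
  unique-++-disjoint (x ∷ xs) u (here refl) x∈ys = unique-head u (∈-++⁺ʳ xs x∈ys)
  unique-++-disjoint (x ∷ xs) u (there x∈)  x∈ys = unique-++-disjoint xs (unique-tail u) x∈ x∈ys

  extract : ∀ {x} {xs : List A} → x ∈ xs → ∃ λ ys → xs ↭ x ∷ ys
  extract x∈ with ∈-∃++ x∈
  ... | ys , zs , refl = ys ++ zs , shift _ ys zs

  ∈-∷⁻ : ∀ {x y} {ys : List A} → x ∈ y ∷ ys → x ≢ y → x ∈ ys
  ∈-∷⁻ (here x≡y) x≢y = ⊥-elim (x≢y x≡y)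
  ∈-∷⁻ (there x∈) _   = x∈

  unique-⊆⇒length-≤ : ∀ {xs ys : List A} → Unique xs → xs ⊆ ys → length xs ≤ length ys
  unique-⊆⇒length-≤ {[]}     _ _ = z≤n
  unique-⊆⇒length-≤ {x ∷ xs} u s with extract (s (here refl))
  ... | zs , π = ≤-trans (s≤s (unique-⊆⇒length-≤ (unique-tail u) sub)) (≤-reflexive (sym (↭-length π)))
    where
    sub : xs ⊆ zs
    sub z∈ = ∈-∷⁻ (∈-resp-↭ π (s (there z∈))) (λ { refl → unique-head u z∈ })

  ++-↭-∷∷ : ∀ {x y} {xs ys R S : List A} → xs ↭ x ∷ R → ys ↭ y ∷ S → xs ++ ys ↭ x ∷ y ∷ (R ++ S)
  ++-↭-∷∷ {x} {y} {R = R} {S} π ρ = ↭-trans (++⁺ π ρ) (↭-prep x (shift y R S))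

  rotate₄ : ∀ {x y z w} {xs : List A} → x ∷ y ∷ z ∷ w ∷ xs ↭ z ∷ w ∷ x ∷ y ∷ xs
  rotate₄ {x} {y} {z} {w} = shifts (x ∷ y ∷ []) (z ∷ w ∷ [])

-- Perfect matchings of lists of vertices

module _ {V : Set} where

  -- The permutation in `pair` makes the order of the list irrelevant. Repetitions are not excluded
  -- here; `Unique` is assumed separately where it matters.
  data PM (E : V → V → Set) : List V → Set where
    []   : PM E []
    pair : ∀ {a b L L′} → E a b → PM E L → L′ ↭ a ∷ b ∷ L → PM E L′

  PM-∷∷ : ∀ {E a b L} → E a b → PM E L → PM E (a ∷ b ∷ L)
  PM-∷∷ e m = pair e m ↭-refl

  PM-resp-↭ : ∀ {E L L′} → L ↭ L′ → PM E L → PM E L′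
  PM-resp-↭ π []           rewrite ↭-empty-inv (↭-sym π) = []
  PM-resp-↭ π (pair e m ρ) = pair e m (↭-trans (↭-sym π) ρ)

  PM-map : ∀ {E F : V → V → Set} {L} → (∀ {a b} → E a b → F a b) → PM E L → PM F L
  PM-map f []           = []
  PM-map f (pair e m π) = pair (f e) (PM-map f m) π

  PM-++ : ∀ {E K L} → PM E K → PM E L → PM E (K ++ L)
  PM-++ [] n = n
  PM-++ {L = L} (pair e m π) n = pair e (PM-++ m n) (++⁺ π (↭-refl {x = L}))

  PM-even : ∀ {E L} → PM E L → ∃ λ m → length L ≡ m + m
  PM-even [] = 0 , refl
  PM-even (pair e m π) with PM-even m
  ... | h , eq = suc h , trans (↭-length π) (cong suc (trans (cong suc eq) (sym (+-suc h h))))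

  module _ {E : V → V → Set} (E-sym : Symmetric E) where

    PM-mate : ∀ {L a} → PM E L → a ∈ L → ∃₂ λ b R → E a b × L ↭ a ∷ b ∷ R × PM E R
    PM-mate (pair {x} {y} e m π) a∈ with ∈-resp-↭ π a∈
    ... | here refl         = y , _ , e , π , m
    ... | there (here refl) = x , _ , E-sym e , ↭-trans π (↭-swap x y ↭-refl) , m
    ... | there (there a∈L) with PM-mate m a∈L
    ... | b , R , eab , ρ , n =
      b , x ∷ y ∷ R , eab , ↭-trans π (↭-trans (↭-prep x (↭-prep y ρ)) rotate₄) , PM-∷∷ e n

  _+edge_,_ : (V → V → Set) → V → V → (V → V → Set)
  (E +edge x , y) a b = E a b ⊎ (a ≡ x × b ≡ y) ⊎ (a ≡ y × b ≡ x)

  +edge-sym : ∀ {E x y} → Symmetric E → Symmetric (E +edge x , y)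
  +edge-sym E-sym (inj₁ e)               = inj₁ (E-sym e)
  +edge-sym E-sym (inj₂ (inj₁ (p , q))) = inj₂ (inj₂ (q , p))
  +edge-sym E-sym (inj₂ (inj₂ (p , q))) = inj₂ (inj₁ (q , p))

  -- A list without repetitions contains `x` and `y` at most once, so the added edge serves in at
  -- most one pair. In the second case that pair is split off and `S` is matched by old edges.
  PM-+edge⁻ : ∀ {E x y L} → Unique L → PM (E +edge x , y) L →
              PM E L ⊎ ∃ λ S → L ↭ x ∷ y ∷ S × PM E S
  PM-+edge⁻ u [] = inj₁ []
  PM-+edge⁻ {E} {x} {y} {L} u (pair {a} {b} {L₀} e m π)
    with Unique-resp-↭ π u
  ... | u′ with PM-+edge⁻ (unique-tail (unique-tail u′)) m
  PM-+edge⁻ u (pair (inj₁ e) m π) | u′ | inj₁ n = inj₁ (pair e n π)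
  PM-+edge⁻ u (pair {a} {b} (inj₁ e) m π) | u′ | inj₂ (S , ρ , n) =
    inj₂ (a ∷ b ∷ S , ↭-trans π (↭-trans (↭-prep a (↭-prep b ρ)) rotate₄) , PM-∷∷ e n)
  PM-+edge⁻ u (pair (inj₂ (inj₁ (refl , refl))) m π) | u′ | inj₁ n = inj₂ (_ , π , n)
  PM-+edge⁻ u (pair {a} {b} (inj₂ (inj₂ (refl , refl))) m π) | u′ | inj₁ n =
    inj₂ (_ , ↭-trans π (↭-swap a b ↭-refl) , n)
  PM-+edge⁻ u (pair (inj₂ (inj₁ (refl , refl))) m π) | u′ | inj₂ (S , ρ , n) =
    ⊥-elim (unique-head u′ (there (∈-resp-↭ (↭-sym ρ) (here refl))))
  PM-+edge⁻ u (pair (inj₂ (inj₂ (refl , refl))) m π) | u′ | inj₂ (S , ρ , n) =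
    ⊥-elim (unique-head u′ (there (∈-resp-↭ (↭-sym ρ) (there (here refl)))))

  -- Augmenting a matching by a larger one

  module Exchange (_≟_ : DecidableEquality V) where

    open DecMembership _≟_ using (_∈?_)

    -- The outcome of flipping an augmenting path: the covered set keeps all of `R` and gains two
    -- vertices of the larger matched set `N`.
    Augments : (V → V → Set) → List V → List V → Set
    Augments E R N = ∃₂ λ p q → p ∈ N × q ∈ N × p ≢ q × p ∉ R × q ∉ R × PM E (p ∷ q ∷ R)

    private
      lift : ∀ {E a b R R′ N N′} → R ↭ a ∷ b ∷ R′ → a ∉ N′ → b ∉ N′ → N′ ⊆ N →
             (∀ {p q} → p ∈ N′ → q ∈ N′ → p ≢ q → p ∉ R′ → q ∉ R′ → PM E (a ∷ b ∷ p ∷ q ∷ R′) → Augments E R N)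
      lift {a = a} {b} {R} {R′} {N} {N′} π a∉ b∉ sub {p} {q} p∈ q∈ p≢q p∉ q∉ m =
        p , q , sub p∈ , sub q∈ , p≢q , out p∈ p∉ , out q∈ q∉ ,
        PM-resp-↭ (↭-trans (↭-sym rotate₄) (↭-prep p (↭-prep q (↭-sym π)))) m
        where
        out : ∀ {z} → z ∈ N′ → z ∉ R′ → z ∉ R
        out z∈ z∉ z∈R with ∈-resp-↭ π z∈R
        ... | here refl           = a∉ z∈
        ... | there (here refl)   = b∉ z∈
        ... | there (there z∈R′) = z∉ z∈R′

    -- Induction on the matching of `R`: drop one of its edges `a b` together with at most two
    -- vertices of `N`, augment the rest, and cover `a` and `b` again. `F` stays fixed while `E`
    -- acquires virtual edges, so the matching of `R` is never rebuilt and the recursion is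
    -- structural in it.
    augment : ∀ {F E R N} → (∀ {a b} → F a b → E a b) → Symmetric E → Unique R → Unique N →
              PM F R → PM E N → length R < length N → Augments E R N
    augment F⇒E E-sym uR uN [] [] ()
    augment F⇒E E-sym uR uN [] (pair {a} {b} e n π) _ =
      a , b , ∈-resp-↭ (↭-sym π) (here refl) , ∈-resp-↭ (↭-sym π) (there (here refl)) ,
      (λ { refl → unique-head (Unique-resp-↭ π uN) (here refl) }) , (λ ()) , (λ ()) , PM-∷∷ e []
    augment {F} {E} {R} {N} F⇒E E-sym uR uN (pair {a} {b} {R′} e₀ m π) n R<N = go (a ∈? N) (b ∈? N)
      where
      e : E a b
      e = F⇒E e₀

      uR′ : Unique R′
      uR′ = unique-tail (unique-tail (Unique-resp-↭ π uR))

      R′<N : suc (suc (length R′)) < length N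
      R′<N = subst (_< length N) (↭-length π) R<N

      delete : ∀ {N′} → a ∉ N′ → b ∉ N′ → N′ ⊆ N → Unique N′ → PM E N′ → length R′ < length N′ → Augments E R N
      delete a∉ b∉ sub u n′ len with augment F⇒E E-sym uR′ u m n′ len
      ... | p , q , p∈ , q∈ , p≢q , p∉ , q∉ , m′ =
        lift {R′ = R′} π a∉ b∉ sub p∈ q∈ p≢q p∉ q∉ (PM-∷∷ e m′)

      -- The path a′ – a – b – b′ is contracted to the single edge a′ – b′.
      contract : ∀ {a′ b′ S} → E a a′ → E b b′ → N ↭ a ∷ a′ ∷ b ∷ b′ ∷ S → PM E S → Augments E R N
      contract {a′} {b′} {S} eaa′ ebb′ ρ s
        with augment (λ f → inj₁ (F⇒E f)) (+edge-sym E-sym) uR′ uN′ m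
               (PM-∷∷ (inj₂ (inj₁ (refl , refl))) (PM-map inj₁ s))
               (s≤s⁻¹ (s≤s⁻¹ (subst (suc (suc (length R′)) <_) (↭-length ρ) R′<N)))
        where
        uN′ : Unique (a′ ∷ b′ ∷ S)
        uN′ = unique-tail (unique-tail (Unique-resp-↭ (↭-trans ρ (↭-prep a (↭-swap a′ b ↭-refl))) uN))
      ... | p , q , p∈ , q∈ , p≢q , p∉ , q∉ , m′ =
        lift {R′ = R′} π (λ z → unique-head u₀ (there z)) (unique-head (unique-tail u₀)) sub
          p∈ q∈ p≢q p∉ q∉ (expand (PM-+edge⁻ upq m′))
        where
        ρ′ : N ↭ a ∷ b ∷ a′ ∷ b′ ∷ S
        ρ′ = ↭-trans ρ (↭-prep a (↭-swap a′ b ↭-refl))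
        u₀ : Unique (a ∷ b ∷ a′ ∷ b′ ∷ S)
        u₀ = Unique-resp-↭ ρ′ uN
        sub : a′ ∷ b′ ∷ S ⊆ N
        sub z∈ = ∈-resp-↭ (↭-sym ρ′) (there (there z∈))
        upq : Unique (p ∷ q ∷ R′)
        upq = ∷-unique (λ { (here r) → p≢q r ; (there r) → p∉ r }) (∷-unique q∉ uR′)
        -- If the virtual edge from `a′` to `b′` is used, the edges `a a′` and `b b′` replace it;
        -- otherwise `a b` is added. Either way `a` and `b` become covered.
        expand : PM E (p ∷ q ∷ R′) ⊎ (∃ λ T → p ∷ q ∷ R′ ↭ a′ ∷ b′ ∷ T × PM E T) →
                 PM E (a ∷ b ∷ p ∷ q ∷ R′)
        expand (inj₁ m″)          = PM-∷∷ e m″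
        expand (inj₂ (T , τ , t)) = pair eaa′ (PM-∷∷ ebb′ t)
          (↭-prep a (↭-trans (↭-prep b τ) (↭-swap b a′ ↭-refl)))

      mate-removed : ∀ {c c′ S} → N ↭ c ∷ c′ ∷ S → length R′ < length S
      mate-removed ρ = s≤s⁻¹ (s≤s⁻¹ (subst (suc (suc (length R′)) <_) (↭-length ρ) R′<N))

      go : _ → _ → Augments E R N
      go (no a∉) (no b∉) = delete a∉ b∉ (λ z → z) uN n (≤-trans (n≤1+n _) (≤-trans (n≤1+n _) R′<N))
      go (yes a∈) b? with PM-mate E-sym n a∈
      go (yes a∈) b? | a′ , S , eaa′ , ρ , s with Unique-resp-↭ ρ uN
      go (yes a∈) (no b∉) | a′ , S , eaa′ , ρ , s | u =
        delete (λ z → unique-head u (there z)) (λ z → b∉ (∈-resp-↭ (↭-sym ρ) (there (there z))))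
          (λ z → ∈-resp-↭ (↭-sym ρ) (there (there z))) (unique-tail (unique-tail u)) s (mate-removed ρ)
      go (yes a∈) (yes b∈) | a′ , S , eaa′ , ρ , s | u with ∈-resp-↭ ρ b∈
      ... | here refl = ⊥-elim (unique-head (Unique-resp-↭ π uR) (here refl))
      ... | there (here refl) =
        delete (λ z → unique-head u (there z)) (unique-head (unique-tail u))
          (λ z → ∈-resp-↭ (↭-sym ρ) (there (there z))) (unique-tail (unique-tail u)) s (mate-removed ρ)
      ... | there (there b∈S) with PM-mate E-sym s b∈S
      ... | b′ , T , ebb′ , τ , t = contract eaa′ ebb′ (↭-trans ρ (↭-prep a (↭-prep a′ τ))) t
      go (no a∉) (yes b∈) with PM-mate E-sym n b∈
      ... | b′ , S , ebb′ , ρ , s =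
        delete (λ z → a∉ (∈-resp-↭ (↭-sym ρ) (there (there z)))) (λ z → unique-head u (there z))
          (λ z → ∈-resp-↭ (↭-sym ρ) (there (there z))) (unique-tail (unique-tail u)) s (mate-removed ρ)
        where
        u = Unique-resp-↭ ρ uN

  -- Factor-critical and linkable vertex sets

  PM-minus₁ : (V → V → Set) → List V → V → Set
  PM-minus₁ E A a = ∃ λ R → A ↭ a ∷ R × PM E R

  PM-minus₂ : (V → V → Set) → List V → V → V → Set
  PM-minus₂ E D u w = ∃ λ R → D ↭ u ∷ w ∷ R × PM E R

  -- The root makes `A` nonempty; the empty list would satisfy `minus` vacuously.
  record FactorCritical (E : V → V → Set) (A : List V) : Set where
    constructor fc
    field
      {root} : V
      root∈  : root ∈ A
      minus  : ∀ {a} → a ∈ A → PM-minus₁ E A a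

  -- If D has a perfect matching, this says that D plus a new vertex joined to d and d′ is factor-critical.
  Linked : (V → V → Set) → List V → V → V → Set
  Linked E D d d′ = ∀ {u} → u ∈ D → PM-minus₂ E D u d ⊎ PM-minus₂ E D u d′

  -- In `link`, `d` stands for the vertex hit by an edge from another part, and its partner for the
  -- vertex at which a second edge should arrive.
  record Linkable (E : V → V → Set) (D : List V) : Set where
    constructor lk
    field
      perfect : PM E D
      link    : ∀ {d} → d ∈ D → ∃ (Linked E D d)

  PM-minus₂-resp : ∀ {E D D′ u w} → D ↭ D′ → PM-minus₂ E D u w → PM-minus₂ E D′ u w
  PM-minus₂-resp π (R , ρ , m) = R , ↭-trans (↭-sym π) ρ , m

  FactorCritical-map : ∀ {E F : V → V → Set} {A} → (∀ {a b} → E a b → F a b) → FactorCritical E A → FactorCritical F A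
  FactorCritical-map f (fc r m) = fc r λ a∈ → let R , π , n = m a∈ in R , π , PM-map f n

  Linked-map : ∀ {E F : V → V → Set} {D d d′} → (∀ {a b} → E a b → F a b) → Linked E D d d′ → Linked F D d d′
  Linked-map f l u∈ = [ (λ (R , π , m) → inj₁ (R , π , PM-map f m))
                      , (λ (R , π , m) → inj₂ (R , π , PM-map f m)) ]′ (l u∈)

  Linkable-map : ∀ {E F : V → V → Set} {D} → (∀ {a b} → E a b → F a b) → Linkable E D → Linkable F D
  Linkable-map f (lk m l) = lk (PM-map f m) λ d∈ → let d′ , h = l d∈ in d′ , Linked-map f h

  Linked-resp : ∀ {E D D′ d d′} → D ↭ D′ → Linked E D d d′ → Linked E D′ d d′
  Linked-resp π h u∈ with h (∈-resp-↭ (↭-sym π) u∈)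
  ... | inj₁ t = inj₁ (PM-minus₂-resp π t)
  ... | inj₂ t = inj₂ (PM-minus₂-resp π t)

  module _ {E : V → V → Set} where

    -- For `u` in `A`, delete `u` from `A` and `b` from `B`; for `u` in `B`, delete `d` from `A` and
    -- `u` from `B`. Each side is left perfectly matched.
    Linked-join : ∀ {A B b} → FactorCritical E A → FactorCritical E B → b ∈ B →
                ∀ {d} → d ∈ A → Linked E (A ++ B) d b
    Linked-join {A} {B} (fc _ m) (fc _ n) b∈ d∈ u∈ with ∈-++⁻ A u∈
    ... | inj₁ u∈A = let R , π , r = m u∈A ; S , ρ , s = n b∈ in
      inj₂ (R ++ S , ++-↭-∷∷ π ρ , PM-++ r s)
    ... | inj₂ u∈B = let R , π , r = m d∈ ; S , ρ , s = n u∈B in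
      inj₁ (R ++ S , ↭-trans (++-↭-∷∷ π ρ) (↭-swap _ _ ↭-refl) , PM-++ r s)

    -- The edge `a b` completes the matchings of `A` without `a` and `B` without `b`. By
    -- `Linked-join`, `b` is a partner for every vertex of `A` and `a` for every vertex of `B`.
    FactorCritical-join : ∀ {A B a b} → FactorCritical E A → FactorCritical E B → a ∈ A → b ∈ B →
                          E a b → Linkable E (A ++ B)
    FactorCritical-join {A} {B} {a} {b} fA@(fc _ m) fB@(fc _ n) a∈ b∈ e = lk pm link
      where
      pm : PM E (A ++ B)
      pm = let R , π , r = m a∈ ; S , ρ , s = n b∈ in pair e (PM-++ r s) (++-↭-∷∷ π ρ)
      link : ∀ {d} → d ∈ A ++ B → ∃ (Linked E (A ++ B) d)
      link d∈ with ∈-++⁻ A d∈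
      ... | inj₁ d∈A = b , Linked-join fA fB b∈ d∈A
      ... | inj₂ d∈B = a , Linked-resp (++-comm B A) (Linked-join fB fA a∈ d∈B)

    -- A deletion in `A` leaves a matching of the rest of `A` beside the one of `D`. For `u` in `D`,
    -- linkedness leaves `D` matched apart from `u` and one of `d`, `d′`, and the latter is then
    -- matched with `a`.
    FactorCritical-ear : ∀ {A D a d d′} → FactorCritical E A → Linkable E D → a ∈ A → Linked E D d d′ →
                         E a d → E a d′ → FactorCritical E (A ++ D)
    FactorCritical-ear {A} {D} {a} (fc r m) (lk p _) a∈ l ead ead′ = fc (∈-++⁺ˡ r) minus
      where
      through : ∀ {u w} → E a w → PM-minus₂ E D u w → PM-minus₁ E (A ++ D) u
      through {u} {w} e (S , ρ , s) = let R , π , t = m a∈ in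
        a ∷ w ∷ (R ++ S) ,
        ↭-trans (++-↭-∷∷ π ρ) (↭-swap a u (shift w R S)) ,
        PM-∷∷ e (PM-++ t s)
      minus : ∀ {u} → u ∈ A ++ D → PM-minus₁ E (A ++ D) u
      minus u∈ with ∈-++⁻ A u∈
      ... | inj₁ u∈A = let R , π , t = m u∈A in R ++ D , ++⁺ π ↭-refl , PM-++ t p
      ... | inj₂ u∈D with l u∈D
      ... | inj₁ t = through ead t
      ... | inj₂ t = through ead′ t

    -- Each `x` in `D` keeps its old partner `x′`. If `u` lies in `F`, then `F` is matched apart
    -- from `u` and one of `e`, `e′`; the edge there leads to `d` or `d′`, and the link between `x`
    -- and `x′` matches the rest of `D` apart from one of these two.
    Linkable-half : ∀ {D F d d′ e e′} → Linkable E D → Linkable E F → d ∈ D → d′ ∈ D →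
                    Linked E F e e′ → E d e → E d′ e′ →
                    ∀ {x} → x ∈ D → ∃ (Linked E (D ++ F) x)
    Linkable-half {D} {F} {d} {d′} {e} {e′} (lk p l) (lk q _) d∈ d′∈ lF ede ede′ {x} x∈ with l x∈
    ... | x′ , lx = x′ , linked
      where
      inside : ∀ {u w} → PM-minus₂ E D u w → PM-minus₂ E (D ++ F) u w
      inside (R , π , r) = R ++ F , ++⁺ π ↭-refl , PM-++ r q
      cross : ∀ {c f u w} → E c f → PM-minus₂ E F u f → PM-minus₂ E D c w → PM-minus₂ E (D ++ F) u w
      cross {c} {f} {u} {w} ecf (S , ρ , s) (R , π , r) =
        c ∷ f ∷ (R ++ S) ,
        ↭-trans (++-↭-∷∷ π ρ) (↭-trans (↭-prep c (↭-prep u (↭-prep w (shift f R S))))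
          (↭-trans (↭-swap c u ↭-refl) (↭-prep u (↭-swap c w ↭-refl)))) ,
        PM-∷∷ ecf (PM-++ r s)
      linked : Linked E (D ++ F) x x′
      linked u∈ with ∈-++⁻ D u∈
      linked u∈ | inj₁ u∈D with lx u∈D
      ... | inj₁ t = inj₁ (inside t)
      ... | inj₂ t = inj₂ (inside t)
      linked u∈ | inj₂ u∈F with lF u∈F
      linked u∈ | inj₂ u∈F | inj₁ t with lx d∈
      ... | inj₁ s = inj₁ (cross ede t s)
      ... | inj₂ s = inj₂ (cross ede t s)
      linked u∈ | inj₂ u∈F | inj₂ t with lx d′∈
      ... | inj₁ s = inj₁ (cross ede′ t s)
      ... | inj₂ s = inj₂ (cross ede′ t s)

    Linkable-join : ∀ {D F d d′ e e′} → Symmetric E → Linkable E D → Linkable E F →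
                    d ∈ D → d′ ∈ D → e ∈ F → e′ ∈ F →
                    Linked E D d d′ → Linked E F e e′ → E d e → E d′ e′ → Linkable E (D ++ F)
    Linkable-join {D} {F} E-sym lD lF d∈ d′∈ e∈ e′∈ hD hF ede ede′ =
      lk (PM-++ (Linkable.perfect lD) (Linkable.perfect lF)) link
      where
      link : ∀ {x} → x ∈ D ++ F → ∃ (Linked E (D ++ F) x)
      link x∈ with ∈-++⁻ D x∈
      ... | inj₁ x∈D = Linkable-half lD lF d∈ d′∈ hF ede ede′ x∈D
      ... | inj₂ x∈F =
        let x′ , h = Linkable-half lF lD e∈ e′∈ hD (E-sym ede) (E-sym ede′) x∈F
        in x′ , Linked-resp (++-comm F D) h

-- Arithmetic of the numbers of edges of complete graphs

tri : ℕ → ℕ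
tri zero    = 0
tri (suc m) = m + tri m

tri≡C : ∀ m → tri m ≡ m C 2
tri≡C zero    = refl
tri≡C (suc m) = trans (cong₂ _+_ (sym (nC1≡n m)) (tri≡C m)) (nCk+nC[k+1]≡[n+1]C[k+1] m 1)

tri-mono : ∀ {m n} → m ≤ n → tri m ≤ tri n
tri-mono z≤n     = z≤n
tri-mono (s≤s p) = +-mono-≤ p (tri-mono p)

-- Passing from `m` to `m + 2` adds `2m + 1` edges and increases the half by one, altogether
-- `2m + 2`.
tri-parity : ∀ m → 2 ∣ tri m + ⌊ m /2⌋
tri-parity zero          = divides 0 refl
tri-parity (suc zero)    = divides 0 refl
tri-parity (suc (suc m)) with tri-parity m
... | divides q eq = divides (q + suc m) (trans (step m (tri m) ⌊ m /2⌋) (trans (cong (_+ suc m * 2) eq) (step′ q m)))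
  where
  step : ∀ m t h → suc m + (m + t) + suc h ≡ t + h + suc m * 2
  step = solve-∀
  step′ : ∀ q m → q * 2 + suc m * 2 ≡ (q + suc m) * 2
  step′ = solve-∀

≤-half : ∀ m → m ≤ suc (⌊ m /2⌋ + ⌊ m /2⌋)
≤-half zero          = z≤n
≤-half (suc zero)    = s≤s z≤n
≤-half (suc (suc m)) = s≤s (s≤s (≤-trans (≤-half m) (≤-reflexive (sym (+-suc _ _)))))

tri-bound : ∀ m → tri m ≤ tri (suc (⌊ m /2⌋ + ⌊ m /2⌋))
tri-bound m = tri-mono (≤-half m)

tri-odd : ∀ h → tri (suc (h + h)) ≡ h * suc (h + h)
tri-odd zero    = refl
tri-odd (suc h) rewrite +-suc h h | tri-odd h = solve-eq h
  where
  solve-eq : ∀ h → suc (suc (h + h)) + (suc (h + h) + h * suc (h + h)) ≡ suc h * suc (suc (suc (h + h)))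
  solve-eq = solve-∀

-- The difference of the two sides is exactly `4gh`.
tri-superadditive : ∀ g h → tri (suc (g + g)) + tri (suc (h + h)) ≤ tri (suc ((g + h) + (g + h)))
tri-superadditive g h rewrite tri-odd g | tri-odd h | tri-odd (g + h) =
  ≤-trans (m≤m+n _ (4 * (g * h))) (≤-reflexive (expand g h))
  where
  expand : ∀ g h → g * suc (g + g) + h * suc (h + h) + 4 * (g * h) ≡ (g + h) * suc ((g + h) + (g + h))
  expand = solve-∀

¬2∣⇒2∣suc : ∀ m → ¬ 2 ∣ m → 2 ∣ suc m
¬2∣⇒2∣suc zero          ¬p = ⊥-elim (¬p (divides 0 refl))
¬2∣⇒2∣suc (suc zero)    ¬p = divides 1 refl
¬2∣⇒2∣suc (suc (suc m)) ¬p with ¬2∣⇒2∣suc m (λ { (divides q eq) → ¬p (divides (suc q) (cong (λ z → suc (suc z)) eq)) })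
... | divides q eq = divides (suc q) (cong (λ z → suc (suc z)) eq)

¬2∣-both : ∀ {m} → 2 ∣ m → 2 ∣ suc m → ⊥
¬2∣-both {m} p q with ∣m+n∣m⇒∣n (subst (2 ∣_) (+-comm 1 m) q) p
... | divides zero    ()
... | divides (suc _) ()

2∣-suc₂ : ∀ {m} → 2 ∣ m → 2 ∣ suc (suc m)
2∣-suc₂ p = ∣m∣n⇒∣m+n (divides 1 refl) p

half-even : ∀ h m → ⌊ (h + h) + m /2⌋ ≡ h + ⌊ m /2⌋
half-even zero    m = refl
half-even (suc h) m = trans (cong (λ z → ⌊ suc z + m /2⌋) (+-suc h h)) (cong suc (half-even h m))

double-≤⁻ : ∀ {i j} → i + i ≤ j + j → i ≤ j
double-≤⁻ {i} {j} p = subst₂ _≤_ (sym (n≡⌊n+n/2⌋ i)) (sym (n≡⌊n+n/2⌋ j)) (⌊n/2⌋-mono p)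

double-+ : ∀ a b → (a + a) + (b + b) ≡ (a + b) + (a + b)
double-+ = solve-∀

concat-↭ : ∀ {A : Set} {P Q : List (List A)} → P ↭ Q → concat P ↭ concat Q
concat-↭ refl         = refl
concat-↭ (prep X π)   = ++⁺ˡ X (concat-↭ π)
concat-↭ (swap X Y π) = ↭-trans (shifts X Y) (++⁺ˡ Y (++⁺ˡ X (concat-↭ π)))
concat-↭ (↭.trans π ρ)  = ↭-trans (concat-↭ π) (concat-↭ ρ)

-- Vertices, edges and adjacency

module _ {n : ℕ} where

  V : Set
  V = Fin n

  _≟ᵉ_ : DecidableEquality (Edge n)
  _≟ᵉ_ = ≡-dec _≟_ _≟_

  open DecMembership _≟ᵉ_ using () renaming (_∈?_ to _∈ᵉ?_) public
  open DecMembership (_≟_ {n}) using (_∈?_) public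

  Adj : Graph n → V → V → Set
  Adj G a b = (a , b) ∈ G ⊎ (b , a) ∈ G

  Adj-sym : ∀ {G} → Symmetric (Adj G)
  Adj-sym (inj₁ p) = inj₂ p
  Adj-sym (inj₂ p) = inj₁ p

  Adj-there : ∀ {G e a b} → Adj G a b → Adj (e ∷ G) a b
  Adj-there (inj₁ p) = inj₁ (there p)
  Adj-there (inj₂ p) = inj₂ (there p)

  Adj-∷⁻ : ∀ {G x y a b} → Adj ((x , y) ∷ G) a b → (Adj G +edge x , y) a b
  Adj-∷⁻ (inj₁ (here refl)) = inj₂ (inj₁ (refl , refl))
  Adj-∷⁻ (inj₁ (there p))   = inj₁ (inj₁ p)
  Adj-∷⁻ (inj₂ (here refl)) = inj₂ (inj₂ (refl , refl))
  Adj-∷⁻ (inj₂ (there p))   = inj₁ (inj₂ p)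

  -- Legal edges have the smaller endpoint first; this picks that representative of an unordered
  -- pair.
  ⟪_,_⟫ : V → V → Edge n
  ⟪ x , y ⟫ with x <ᶠ? y
  ... | yes _ = x , y
  ... | no  _ = y , x

  ⟪⟫-cases : ∀ x y → ⟪ x , y ⟫ ≡ (x , y) ⊎ ⟪ x , y ⟫ ≡ (y , x)
  ⟪⟫-cases x y with x <ᶠ? y
  ... | yes _ = inj₁ refl
  ... | no  _ = inj₂ refl

  Sorted : Edge n → Set
  Sorted (i , j) = i <ᶠ j

  ⟪⟫-sorted : ∀ x y → x ≢ y → Sorted ⟪ x , y ⟫
  ⟪⟫-sorted x y x≢y with x <ᶠ? y
  ... | yes p = p
  ... | no ¬p with <ᶠ-cmp x y
  ... | tri< p _ _ = ⊥-elim (¬p p)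
  ... | tri≈ _ p _ = ⊥-elim (x≢y p)
  ... | tri> _ _ p = p

  ⟪⟫-of-sorted : ∀ {x y} → x <ᶠ y → ⟪ x , y ⟫ ≡ (x , y)
  ⟪⟫-of-sorted {x} {y} p with x <ᶠ? y
  ... | yes _ = refl
  ... | no ¬p = ⊥-elim (¬p p)

  ⟪⟫-of-sorted′ : ∀ {x y} → x <ᶠ y → ⟪ y , x ⟫ ≡ (x , y)
  ⟪⟫-of-sorted′ {x} {y} p with y <ᶠ? x
  ... | yes q = ⊥-elim (<ᶠ-asym {x = x} {y} p q)
  ... | no _  = refl

  ⟪⟫-injective : ∀ {x y z} → ⟪ x , y ⟫ ≡ ⟪ x , z ⟫ → y ≡ z
  ⟪⟫-injective {x} {y} {z} eq with ⟪⟫-cases x y | ⟪⟫-cases x z | eq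
  ... | inj₁ p | inj₁ q | eq′ = cong proj₂ (trans (sym p) (trans eq′ q))
  ... | inj₁ p | inj₂ q | eq′ = let r = trans (sym p) (trans eq′ q) in trans (cong proj₂ r) (cong proj₁ r)
  ... | inj₂ p | inj₁ q | eq′ = let r = trans (sym p) (trans eq′ q) in trans (cong proj₁ r) (cong proj₂ r)
  ... | inj₂ p | inj₂ q | eq′ = cong proj₁ (trans (sym p) (trans eq′ q))

  Adj-⟪⟫ : ∀ {G x y} → ⟪ x , y ⟫ ∈ G → Adj G x y
  Adj-⟪⟫ {G} {x} {y} p with ⟪⟫-cases x y
  ... | inj₁ eq = inj₁ (subst (_∈ G) eq p)
  ... | inj₂ eq = inj₂ (subst (_∈ G) eq p)

  pairs : List V → List (Edge n)
  pairs []       = []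
  pairs (x ∷ xs) = map ⟪ x ,_⟫ xs ++ pairs xs

  length-pairs : ∀ xs → length (pairs xs) ≡ tri (length xs)
  length-pairs []       = refl
  length-pairs (x ∷ xs) =
    trans (length-++ (map ⟪ x ,_⟫ xs)) (cong₂ _+_ (length-map ⟪ x ,_⟫ xs) (length-pairs xs))

  ∈-pairs⁺ : ∀ {xs x y} → x ∈ xs → y ∈ xs → x <ᶠ y → (x , y) ∈ pairs xs
  ∈-pairs⁺ {x = x} (here refl) (here refl) x<y = ⊥-elim (<ᶠ-irrefl {x = x} refl x<y)
  ∈-pairs⁺ {x ∷ xs} (here refl) (there y∈) x<y =
    ∈-++⁺ˡ (subst (_∈ map ⟪ x ,_⟫ xs) (⟪⟫-of-sorted x<y) (∈-map⁺ ⟪ x ,_⟫ y∈))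
  ∈-pairs⁺ {y ∷ xs} (there x∈) (here refl) x<y =
    ∈-++⁺ˡ (subst (_∈ map ⟪ y ,_⟫ xs) (⟪⟫-of-sorted′ x<y) (∈-map⁺ ⟪ y ,_⟫ x∈))
  ∈-pairs⁺ {z ∷ xs} (there x∈) (there y∈) x<y = ∈-++⁺ʳ (map ⟪ z ,_⟫ xs) (∈-pairs⁺ x∈ y∈ x<y)

  Within : List V → Edge n → Set
  Within X (x , y) = x ∈ X × y ∈ X

  Within-⟪⟫ : ∀ {X} x y → x ∈ X → y ∈ X → Within X ⟪ x , y ⟫
  Within-⟪⟫ x y p q with x <ᶠ? y
  ... | yes _ = p , q
  ... | no  _ = q , p

  ∈-pairs⁻ : ∀ {xs e} → Unique xs → e ∈ pairs xs → Sorted e × Within xs e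
  ∈-pairs⁻ {x ∷ xs} u e∈ with ∈-++⁻ (map ⟪ x ,_⟫ xs) e∈
  ... | inj₁ e∈₁ with ∈-map⁻ ⟪ x ,_⟫ e∈₁
  ... | y , y∈ , refl = ⟪⟫-sorted x y (λ { refl → unique-head u y∈ }) , Within-⟪⟫ x y (here refl) (there y∈)
  ∈-pairs⁻ {x ∷ xs} u e∈ | inj₂ e∈₂ with ∈-pairs⁻ (unique-tail u) e∈₂
  ... | s , p , q = s , there p , there q

  pairs-unique : ∀ {xs} → Unique xs → Unique (pairs xs)
  pairs-unique {[]}     u = []
  pairs-unique {x ∷ xs} u =
    Uniqueₚ.++⁺ (Uniqueₚ.map⁺ ⟪⟫-injective (unique-tail u)) (pairs-unique (unique-tail u)) disj
    where
    disj : ∀ {e} → ¬ (e ∈ map ⟪ x ,_⟫ xs × e ∈ pairs xs)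
    disj (p , q) with ∈-map⁻ ⟪ x ,_⟫ p
    ... | y , y∈ , refl with ∈-pairs⁻ (unique-tail u) q | ⟪⟫-cases x y
    ... | _ , w | inj₁ eq = unique-head u (subst (λ e → proj₁ e ∈ xs) eq (proj₁ w))
    ... | _ , w | inj₂ eq = unique-head u (subst (λ e → proj₂ e ∈ xs) eq (proj₂ w))

  -- Matchings as perfect matchings of vertex lists

  flatten : List (Edge n) → List V
  flatten []            = []
  flatten ((a , b) ∷ M) = a ∷ b ∷ flatten M

  -- `Disjoint` compares different edges only; that the two ends of a single edge differ comes from
  -- sortedness.
  matching⇒PM : ∀ {k G} → All Sorted G → HasMatching k G →
                ∃ λ L → Unique L × PM (Adj G) L × length L ≡ k + k
  matching⇒PM {G = G} srt (M , refl , M⊆G , disj) = flatten M , unique M M⊆G disj , perfect M M⊆G , len M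
    where
    outside : ∀ M {a b c} → c ≡ a ⊎ c ≡ b → All (Disjoint (a , b)) M → c ∉ flatten M
    outside (e ∷ M) (inj₁ refl) ((p , _ , _ , _) ∷ _) (here refl)         = p refl
    outside (e ∷ M) (inj₁ refl) ((_ , p , _ , _) ∷ _) (there (here refl)) = p refl
    outside (e ∷ M) (inj₂ refl) ((_ , _ , p , _) ∷ _) (here refl)         = p refl
    outside (e ∷ M) (inj₂ refl) ((_ , _ , _ , p) ∷ _) (there (here refl)) = p refl
    outside (e ∷ M) c (_ ∷ d) (there (there c∈)) = outside M c d c∈

    unique : ∀ M → All (_∈ G) M → AllPairs Disjoint M → Unique (flatten M)
    unique []            _        _        = []
    unique ((a , b) ∷ M) (p ∷ ps) (d ∷ ds) =
      ∷-unique (λ { (here refl) → <ᶠ-irrefl {x = a} refl (All.lookup srt p) ; (there a∈) → outside M (inj₁ refl) d a∈ })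
        (∷-unique (outside M (inj₂ refl) d) (unique M ps ds))

    perfect : ∀ M → All (_∈ G) M → PM (Adj G) (flatten M)
    perfect []      []       = []
    perfect (e ∷ M) (p ∷ ps) = PM-∷∷ (inj₁ p) (perfect M ps)

    len : ∀ M → length (flatten M) ≡ length M + length M
    len []      = refl
    len (e ∷ M) = cong suc (trans (cong suc (len M)) (sym (+-suc (length M) (length M))))

  PM⇒matching : ∀ {k G L} → Unique L → PM (Adj G) L → length L ≡ k + k → HasMatching k G
  PM⇒matching {k} {G} u m len =
    let M , l , M⊆G , d , _ = build u m in M , double-injective (trans l len) , M⊆G , d
    where
    double-injective : ∀ {i j} → i + i ≡ j + j → i ≡ j
    double-injective {zero}  {zero}  _  = refl
    double-injective {suc i} {suc j} eq =
      cong suc (double-injective (suc-injective (suc-injective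
        (trans (sym (cong suc (+-suc i i))) (trans eq (cong suc (+-suc j j)))))))

    apart : ∀ {L a b} → a ∉ L → b ∉ L → ∀ {e} → Within L e → Disjoint (a , b) e
    apart a∉ b∉ (c∈ , d∈) =
      (λ { refl → a∉ c∈ }) , (λ { refl → a∉ d∈ }) , (λ { refl → b∉ c∈ }) , (λ { refl → b∉ d∈ })

    -- The last component keeps the chosen edges within `L`, which makes the next edge disjoint from
    -- all of them.
    build : ∀ {L} → Unique L → PM (Adj G) L →
            ∃ λ M → length M + length M ≡ length L × All (_∈ G) M × AllPairs Disjoint M × All (Within L) M
    build u [] = [] , refl , [] , [] , []
    build {L} u (pair {a} {b} {L₀} e m π) with Unique-resp-↭ π u
    ... | u′ with build (unique-tail (unique-tail u′)) m
    ... | M , l , M⊆G , d , w = add e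
      where
      len′ : suc (length M) + suc (length M) ≡ length L
      len′ = trans (cong suc (+-suc (length M) (length M))) (trans (cong (λ z → suc (suc z)) l) (sym (↭-length π)))
      a∈ : a ∈ L
      a∈ = ∈-resp-↭ (↭-sym π) (here refl)
      b∈ : b ∈ L
      b∈ = ∈-resp-↭ (↭-sym π) (there (here refl))
      a∉ : a ∉ L₀
      a∉ p = unique-head u′ (there p)
      b∉ : b ∉ L₀
      b∉ = unique-head (unique-tail u′)
      up : ∀ {e} → Within L₀ e → Within L e
      up (p , q) = ∈-resp-↭ (↭-sym π) (there (there p)) , ∈-resp-↭ (↭-sym π) (there (there q))
      add : Adj G a b → _
      add (inj₁ p) = (a , b) ∷ M , len′ , p ∷ M⊆G , All.map (apart a∉ b∉) w ∷ d , (a∈ , b∈) ∷ All.map up w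
      add (inj₂ p) = (b , a) ∷ M , len′ , p ∷ M⊆G , All.map (apart b∉ a∉) w ∷ d , (b∈ , a∈) ∷ All.map up w

  -- Positions and unrestricted play

  record Valid (k : ℕ) (G : Graph n) : Set where
    constructor valid
    field
      unique : Unique G
      sorted : All Sorted G
      free   : ¬ HasMatching k G

  Valid-∷ : ∀ {k G e} → Valid k G → Legal k G e → Valid k (e ∷ G)
  Valid-∷ (valid u s _) (p , q , r) = valid (∷-unique q u) (p ∷ s) r

  Valid-[] : ∀ {k} → 1 ≤ k → Valid k []
  Valid-[] 1≤k = valid [] [] λ { ([] , refl , _) → 1+n≰n 1≤k ; (_ ∷ _ , _ , () ∷ _ , _) }

  Within⇒length≤ : ∀ {G X} → Unique G → All Sorted G → All (Within X) G → length G ≤ tri (length X)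
  Within⇒length≤ {G} {X} u s w = subst (length G ≤_) (length-pairs X)
    (unique-⊆⇒length-≤ u λ e∈ → ∈-pairs⁺ (proj₁ (All.lookup w e∈)) (proj₂ (All.lookup w e∈)) (All.lookup s e∈))

  ∣allFin∣ : length (allFin n) ≡ n
  ∣allFin∣ = length-tabulate {n = n} (λ z → z)

  all-within : {G : Graph n} → All (Within (allFin n)) G
  all-within = All.tabulate λ {e} _ → ∈-allFin (proj₁ e) , ∈-allFin (proj₂ e)

  Valid⇒length≤ : ∀ {k G} → Valid k G → length G ≤ tri n
  Valid⇒length≤ {G = G} (valid u s _) =
    subst (λ m → length G ≤ tri m) ∣allFin∣
      (Within⇒length≤ u s all-within)

  disjoint? : (e f : Edge n) → Dec (Disjoint e f)
  disjoint? (a , b) (c , d) = ¬? (a ≟ c) ×-dec ¬? (a ≟ d) ×-dec ¬? (b ≟ c) ×-dec ¬? (b ≟ d)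

  private
    -- `N` collects the edges already picked, so that the search for a matching can recurse on `k`.
    Extension : ℕ → Graph n → List (Edge n) → Set
    Extension k G N = ∃ λ M → IsMatchingOfSize k G M × All (λ e → All (λ f → Disjoint f e) N) M

    extension? : ∀ k G N → Dec (Extension k G N)
    extension? zero    G N = yes ([] , (refl , [] , []) , [])
    extension? (suc k) G N =
      map′ to from (anyL? (λ e → All.all? (λ f → disjoint? f e) N ×-dec extension? k G (e ∷ N)) G)
      where
      First : Edge n → Set
      First e = All (λ f → Disjoint f e) N × Extension k G (e ∷ N)
      to : Any First G → Extension (suc k) G N
      to any with find any
      ... | e , e∈ , a , M , (l , M⊆G , d) , x =
        e ∷ M , (cong suc l , e∈ ∷ M⊆G , All.map All.head x ∷ d) , a ∷ All.map All.tail x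
      from : Extension (suc k) G N → Any First G
      from (e ∷ M , (l , e∈ ∷ M⊆G , a ∷ d) , x ∷ xs) =
        lose e∈ (x , M , (suc-injective l , M⊆G , d) , All.zipWith (λ (p , q) → p ∷ q) (a , xs))

  hasMatching? : ∀ k (G : Graph n) → Dec (HasMatching k G)
  hasMatching? k G = map′ (λ (M , m , _) → M , m) (λ (M , m) → M , m , All.tabulate λ _ → [])
                          (extension? k G [])

  legal? : ∀ k G (e : Edge n) → Dec (Legal k G e)
  legal? k G e@(i , j) = (i <ᶠ? j) ×-dec ¬? (e ∈ᵉ? G) ×-dec ¬? (hasMatching? k (e ∷ G))

  legalMove? : ∀ k (G : Graph n) → (∃ λ e → Legal k G e) ⊎ Terminal k G
  legalMove? k G with any? (λ i → any? (λ j → legal? k G (i , j)))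
  ... | yes (i , j , l) = inj₁ ((i , j) , l)
  ... | no ¬l           = inj₂ λ (i , j) l → ¬l (i , j , l)

  module _ {k t : ℕ} (I : Graph n → Set) (step : ∀ {G e} → Valid k G → I G → Legal k G e → I (e ∷ G)) where

    -- With an invariant that every legal move preserves, any choice of moves will do. The fuel
    -- cannot run out, because a position has at most `tri n` edges.
    MaxForces-any : (∀ {G} → Valid k G → I G → Terminal k G → t ≤ length G) →
                    ∀ {G} p → Valid k G → I G → MaxForces k t p G
    MaxForces-any end {G} p v i = go (suc (tri n)) p v i (s≤s (m≤m+n _ _))
      where
      go : ∀ fuel {G} p → Valid k G → I G → tri n < fuel + length G → MaxForces k t p G
      go zero       p v i lt = ⊥-elim (<⇒≱ lt (Valid⇒length≤ v))
      go (suc f) {G} p v i lt with legalMove? k G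
      ... | inj₂ T = done T (end v i T)
      go (suc f) {G} Max v i lt | inj₁ (e , l) =
        maxMove e l (go f Mini (Valid-∷ v l) (step v i l) (≤-trans lt (≤-reflexive (sym (+-suc f _)))))
      go (suc f) {G} Mini v i lt | inj₁ (e , l) =
        miniMove (λ T → T e l) λ e l → go f Max (Valid-∷ v l) (step v i l) (≤-trans lt (≤-reflexive (sym (+-suc f _))))

    MiniForces-any : (∀ {G} → Valid k G → I G → Terminal k G → length G ≤ t) →
                     ∀ {G} p → Valid k G → I G → MiniForces k t p G
    MiniForces-any end {G} p v i = go (suc (tri n)) p v i (s≤s (m≤m+n _ _))
      where
      go : ∀ fuel {G} p → Valid k G → I G → tri n < fuel + length G → MiniForces k t p G
      go zero       p v i lt = ⊥-elim (<⇒≱ lt (Valid⇒length≤ v))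
      go (suc f) {G} p v i lt with legalMove? k G
      ... | inj₂ T = done T (end v i T)
      go (suc f) {G} Mini v i lt | inj₁ (e , l) =
        miniMove e l (go f Max (Valid-∷ v l) (step v i l) (≤-trans lt (≤-reflexive (sym (+-suc f _)))))
      go (suc f) {G} Max v i lt | inj₁ (e , l) =
        maxMove (λ T → T e l) λ e l → go f Mini (Valid-∷ v l) (step v i l) (≤-trans lt (≤-reflexive (sym (+-suc f _))))

  -- Legal moves inside a small vertex set

  Adj⇒Within : ∀ {G X a b} → All (Within X) G → Adj G a b → a ∈ X × b ∈ X
  Adj⇒Within w (inj₁ p) = All.lookup w p
  Adj⇒Within w (inj₂ p) = let x , y = All.lookup w p in y , x

  open Exchange (_≟_ {n})

  Adj-covers : ∀ {G : Graph n} {L} → PM (Adj G) L → ∀ {x} → x ∈ L → ∃ λ y → y ∈ L × Adj G x y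
  Adj-covers {G} m x∈ with PM-mate (Adj-sym {G = G}) m x∈
  ... | y , R , e , π , _ = y , ∈-resp-↭ (↭-sym π) (there (here refl)) , e

  Within⇒¬matching : ∀ {k X} {G : Graph n} → All Sorted G → All (Within X) G → length X < k + k → ¬ HasMatching k G
  Within⇒¬matching {X = X} s w lt h with matching⇒PM s h
  ... | L , u , m , len = <⇒≱ lt (subst (_≤ length X) len
    (unique-⊆⇒length-≤ u λ x∈ → let y , _ , e = Adj-covers m x∈ in proj₁ (Adj⇒Within w e)))

  Within⇒Legal : ∀ {k X} {G : Graph n} {e} → Sorted e → e ∉ G → All Sorted G → All (Within X) (e ∷ G) →
                 length X < k + k → Legal k G e
  Within⇒Legal se e∉ s w lt = se , e∉ , Within⇒¬matching (se ∷ s) w lt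

  ∉-⟪⟫ : ∀ {X} {G : Graph n} v w → w ∉ X → All (Within X) G → ⟪ v , w ⟫ ∉ G
  ∉-⟪⟫ {G = G} v w w∉ win p = w∉ (proj₂ (Adj⇒Within win (Adj-⟪⟫ {G = G} {v} {w} p)))

  fresh : (X : List (Fin n)) → length X < n → ∃ λ v → v ∉ X
  fresh X lt with any? (λ v → ¬? (v ∈? X))
  ... | yes p = p
  ... | no ¬p = ⊥-elim (<⇒≱ lt (subst (_≤ length X) ∣allFin∣ (unique-⊆⇒length-≤ (Uniqueₚ.allFin⁺ n)
                  λ {v} _ → decidable-stable (v ∈? X) λ v∉ → ¬p (v , v∉))))

  -- An edge at `x` missing from a terminal graph would still be legal, so all `n ∸ 1` edges at `x`
  -- are present.
  dominating⇒length≥ : ∀ {k} {G : Graph n} (x : Fin n) → Terminal k G →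
    (∀ {y} → x ≢ y → ⟪ x , y ⟫ ∉ G → Legal k G ⟪ x , y ⟫) → n ∸ 1 ≤ length G
  dominating⇒length≥ {G = G} x T leg with extract (∈-allFin x)
  ... | ys , π = subst (_≤ length G)
      (trans (length-map ⟪ x ,_⟫ ys) (cong (_∸ 1) (trans (sym (↭-length π)) ∣allFin∣)))
      (unique-⊆⇒length-≤ (Uniqueₚ.map⁺ ⟪⟫-injective (unique-tail u)) sub)
    where
    u : Unique (x ∷ ys)
    u = Unique-resp-↭ π (Uniqueₚ.allFin⁺ n)
    sub : map ⟪ x ,_⟫ ys ⊆ G
    sub e∈ with ∈-map⁻ ⟪ x ,_⟫ e∈
    ... | y , y∈ , refl = decidable-stable (⟪ x , y ⟫ ∈ᵉ? G)
      λ e∉ → T _ (leg (λ { refl → unique-head u y∈ }) e∉)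

  inhabited : (X : List (Fin n)) → 1 ≤ length X → ∃ λ x → x ∈ X
  inhabited (x ∷ _) _ = x , here refl

  -- Stars beside a matching

  IsEdge : Graph n → Edge n → Fin n → Fin n → Set
  IsEdge G e c d = ∀ {x y} → Adj (e ∷ G) x y → (Adj G +edge c , d) x y

  +edge-swap : ∀ {E : Fin n → Fin n → Set} {x y c d} → (E +edge x , y) c d → (E +edge y , x) c d
  +edge-swap (inj₁ p)        = inj₁ p
  +edge-swap (inj₂ (inj₁ p)) = inj₂ (inj₂ p)
  +edge-swap (inj₂ (inj₂ p)) = inj₂ (inj₁ p)

  Adj-⟪⟫∷⁻ : ∀ {G : Graph n} x y {c d} → Adj (⟪ x , y ⟫ ∷ G) c d → (Adj G +edge x , y) c d
  Adj-⟪⟫∷⁻ {G} x y {c} {d} p with ⟪⟫-cases x y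
  ... | inj₁ eq = Adj-∷⁻ (subst (λ e → Adj (e ∷ G) c d) eq p)
  ... | inj₂ eq = +edge-swap {E = Adj G} (Adj-∷⁻ (subst (λ e → Adj (e ∷ G) c d) eq p))

  -- The matching on `R` has `k − 2` edges. Three leaves are kept because augmenting `R` can occupy
  -- two of them.
  record Star (k : ℕ) (G : Graph n) : Set where
    field
      {a x y z} : Fin n
      {R}       : List (Fin n)
      unique    : Unique (a ∷ x ∷ y ∷ z ∷ R)
      ax        : Adj G a x
      ay        : Adj G a y
      az        : Adj G a z
      perfect   : PM (Adj G) R
      size      : 4 + length R ≡ k + k

  Star-∷ : ∀ {k G e} → Star k G → Star k (e ∷ G)
  Star-∷ {G = G} s = record
    { unique = unique ; ax = Adj-there {G = G} ax ; ay = Adj-there {G = G} ay ; az = Adj-there {G = G} az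
    ; perfect = PM-map (Adj-there {G = G}) perfect ; size = size }
    where open Star s

  -- If the new edge at the centre a completed a k-matching, then G − a would contain a matching
  -- larger than that of R; the latter could be augmented, leaving one of the three leaves free for a.
  Star⇒Legal : ∀ {k G} → Valid k G → (s : Star k G) → ∀ {w} → Star.a s ≢ w → ⟪ Star.a s , w ⟫ ∉ G →
               Legal k G ⟪ Star.a s , w ⟫
  Star⇒Legal {k} {G} v s {w} a≢w e∉ = ⟪⟫-sorted a w a≢w , e∉ , noMatching
    where
    open Star s

    leaf : ∀ p q → ∃ λ l → Adj G a l × l ∉ p ∷ q ∷ [] × l ∈ x ∷ y ∷ z ∷ []
    leaf p q with x ∈? (p ∷ q ∷ []) | y ∈? (p ∷ q ∷ []) | z ∈? (p ∷ q ∷ [])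
    ... | no x∉ | _     | _     = x , ax , x∉ , here refl
    ... | yes _ | no y∉ | _     = y , ay , y∉ , there (here refl)
    ... | yes _ | yes _ | no z∉ = z , az , z∉ , there (there (here refl))
    ... | yes x∈ | yes y∈ | yes z∈ = ⊥-elim (1+n≰n (unique-⊆⇒length-≤ (unique-++ˡ (x ∷ y ∷ z ∷ []) (unique-tail unique))
      λ { (here refl) → x∈ ; (there (here refl)) → y∈ ; (there (there (here refl))) → z∈ }))

    avoiding : ∀ {S} → Unique S → a ∉ S → PM (Adj G) S → 2 + length S ≡ k + k → ⊥
    avoiding {S} uS a∉S m len
      with augment (λ e → e) (Adj-sym {G = G}) (unique-++ʳ (a ∷ x ∷ y ∷ z ∷ []) unique) uS perfect m
             (≤-trans (n≤1+n _) (≤-reflexive (suc-injective (suc-injective (trans size (sym len))))))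
    ... | p , q , p∈ , q∈ , p≢q , p∉ , q∉ , m′ with leaf p q
    ... | l , al , l∉ , l∈ = Valid.free v (PM⇒matching
        (∷-unique a∉′ (∷-unique l∉′ (∷-unique (λ { (here r) → p≢q r ; (there r) → p∉ r })
          (∷-unique q∉ (unique-++ʳ (a ∷ x ∷ y ∷ z ∷ []) unique)))))
        (PM-∷∷ al m′) size)
      where
      l∉′ : l ∉ p ∷ q ∷ R
      l∉′ (here r)           = l∉ (here r)
      l∉′ (there (here r))   = l∉ (there (here r))
      l∉′ (there (there l∈R)) = unique-++-disjoint (x ∷ y ∷ z ∷ []) (unique-tail unique) l∈ l∈R
      a∉R : a ∉ R
      a∉R a∈ = unique-head unique (there (there (there a∈)))
      leaf≢a : a ∉ x ∷ y ∷ z ∷ []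
      leaf≢a (here r)                 = unique-head unique (here r)
      leaf≢a (there (here r))         = unique-head unique (there (here r))
      leaf≢a (there (there (here r))) = unique-head unique (there (there (here r)))
      a∉′ : a ∉ l ∷ p ∷ q ∷ R
      a∉′ (here refl)                     = leaf≢a l∈
      a∉′ (there (here refl))             = a∉S p∈
      a∉′ (there (there (here refl)))     = a∉S q∈
      a∉′ (there (there (there a∈R)))     = a∉R a∈R

    noMatching : ¬ HasMatching k (⟪ a , w ⟫ ∷ G)
    noMatching h with matching⇒PM (⟪⟫-sorted a w a≢w ∷ Valid.sorted v) h
    ... | L , uL , m , len with PM-+edge⁻ uL (PM-map (Adj-⟪⟫∷⁻ a w) m)
    ... | inj₁ m′ = Valid.free v (PM⇒matching uL m′ len)
    ... | inj₂ (S , π , m′) = avoiding (unique-tail (unique-tail u)) (λ a∈ → unique-head u (there a∈)) m′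
                                (trans (sym (↭-length π)) len)
      where
      u = Unique-resp-↭ π uL

  -- Max's strategy

  Max-small : ∀ {k} p → 1 ≤ k → n < k + k → ScoreAtLeast n k p (n ∸ 1)
  Max-small {k} p 1≤k n<2k = MaxForces-any (λ _ → ⊤) (λ _ _ _ → tt) end p (Valid-[] 1≤k) tt
    where
    end : ∀ {G : Graph n} → Valid k G → ⊤ → Terminal k G → n ∸ 1 ≤ length G
    end {G} v _ T with n ℕ.≟ 0
    -- Without vertices there is no centre to choose, but then `n ∸ 1` is zero.
    ... | yes refl = z≤n
    ... | no n≢0   = dominating⇒length≥ (proj₁ x₀) T λ {y} x≢y e∉ →
        Within⇒Legal (⟪⟫-sorted (proj₁ x₀) y x≢y) e∉ (Valid.sorted v) all-within (subst (_< k + k) (sym ∣allFin∣) n<2k)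
      where
      x₀ : ∃ λ (x : Fin n) → x ∉ []
      x₀ = fresh [] (n≢0⇒n>0 n≢0)

  record Covered (G : Graph n) (j : ℕ) (X : List (Fin n)) : Set where
    constructor covered
    field
      unique  : Unique X
      size    : length X ≡ j + j
      perfect : PM (Adj G) X
      within  : All (Within X) G

  Within-mono : ∀ {X Y} → X ⊆ Y → ∀ {e : Edge n} → Within X e → Within Y e
  Within-mono s (p , q) = s p , s q

  Covered-new : ∀ {G j X e v w} → Covered G j X → v ∉ w ∷ X → w ∉ X → Adj (e ∷ G) v w →
                All (Within (v ∷ w ∷ X)) (e ∷ G) → Covered (e ∷ G) (suc j) (v ∷ w ∷ X)
  Covered-new {G} {j} (covered u l m _) v∉ w∉ vw win =
    covered (∷-unique v∉ (∷-unique w∉ u)) (trans (cong (λ z → suc (suc z)) l) (cong suc (sym (+-suc j j))))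
            (PM-∷∷ vw (PM-map (Adj-there {G = G}) m)) win

  Covered-inside : ∀ {G j X e} → Covered G j X → Within X e → Covered (e ∷ G) j X
  Covered-inside {G} (covered u l m w) we = covered u l (PM-map (Adj-there {G = G}) m) (we ∷ w)

  -- `K` is `k − 1`, the number of pairs in `X` once it is full.
  module MaxStrategy (K : ℕ) (1≤K : 1 ≤ K) (2k≤n : suc K + suc K ≤ n) where

    private
      k = suc K

    double< : ∀ {j} → j < K → suc (suc (j + j)) < k + k
    double< {j} lt = s≤s (subst (_≤ K + suc K) (cong suc (+-suc j j)) (+-mono-≤ lt (≤-trans lt (n≤1+n K))))

    double<′ : suc (K + K) < k + k
    double<′ = s≤s (≤-reflexive (sym (+-suc K K)))

    fresh₁ : ∀ {j X d} → length X ≡ j + j → j ≤ K → ∃ λ w → w ∉ d ∷ X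
    fresh₁ {j} l j≤K = fresh _ (≤-trans (s≤s (s≤s (≤-trans (≤-reflexive l) (+-mono-≤ j≤K j≤K))))
      (≤-trans (s≤s (≤-reflexive (sym (+-suc K K)))) 2k≤n))

    newEdge : ∀ {G j X} → Valid k G → Covered G j X → j < K →
              ∃₂ λ e Y → Legal k G e × Covered (e ∷ G) (suc j) Y
    newEdge {G} {j} {X} v c@(covered u l m w) j<K
      with fresh X (≤-trans (s≤s (≤-trans (≤-reflexive l) (≤-trans (n≤1+n _) (n≤1+n _)))) (≤-trans (double< j<K) 2k≤n))
    ... | a , a∉ with fresh₁ {d = a} l (<⇒≤ j<K)
    ... | b , b∉ = ⟪ b , a ⟫ , b ∷ a ∷ X ,
        Within⇒Legal (⟪⟫-sorted b a (λ r → b∉ (here r))) (∉-⟪⟫ b a a∉ w) (Valid.sorted v) win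
          (≤-trans (s≤s (≤-reflexive (cong (λ z → suc (suc z)) l))) (double< j<K)) ,
        Covered-new {G} c b∉ a∉ (Adj-⟪⟫ {G = ⟪ b , a ⟫ ∷ G} (here refl)) win
      where
      win : All (Within (b ∷ a ∷ X)) (⟪ b , a ⟫ ∷ G)
      win = Within-⟪⟫ b a (here refl) (there (here refl)) ∷ All.map (Within-mono (λ z → there (there z))) w

    -- If `X` were complete, `G` would have `tri (K + K)` edges, a number with the parity of `K`;
    -- the hypothesis gives it the parity of `suc K`.
    insideEdge : ∀ {G X} → Valid k G → Covered G K X → 2 ∣ length G + k → ∃ λ e → Legal k G e × Within X e
    insideEdge {G} {X} v (covered u l m w) even with All.all? (_∈ᵉ? G) (pairs X)
    ... | yes all = ⊥-elim (¬2∣-both odd (subst (2 ∣_) (trans (+-suc _ K) (cong (λ z → suc (z + K)) full)) even))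
      where
      full : length G ≡ tri (K + K)
      full = ≤-antisym (subst (λ z → length G ≤ tri z) l (Within⇒length≤ (Valid.unique v) (Valid.sorted v) w))
        (subst (_≤ length G) (trans (length-pairs X) (cong tri l))
          (unique-⊆⇒length-≤ (pairs-unique u) (All.lookup all)))
      odd : 2 ∣ tri (K + K) + K
      odd = subst (λ z → 2 ∣ tri (K + K) + z) (sym (n≡⌊n+n/2⌋ K)) (tri-parity (K + K))
    ... | no ¬all with find (¬All⇒Any¬ (_∈ᵉ? G) (pairs X) ¬all)
    ... | e , e∈ , e∉ = let s , we = ∈-pairs⁻ u e∈ in
        e , Within⇒Legal s e∉ (Valid.sorted v) (we ∷ w)
              (≤-trans (s≤s (≤-trans (≤-reflexive l) (n≤1+n _))) double<′) , we

    -- The centre c meets every edge leaving X, so a k-matching would need k − 1 edges inside X − c.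
    Legal-second : ∀ {G X c d w e} → Valid k (e ∷ G) → Covered G K X → c ∈ X → w ∉ d ∷ X →
                   Within (d ∷ X) e → IsEdge G e c d → Legal k (e ∷ G) ⟪ c , w ⟫
    Legal-second {G} {X} {c} {d} {w} {e} v (covered u l m win) c∈ w∉ we isE =
      srt , ∉-⟪⟫ c w w∉ (we ∷ All.map (Within-mono there) win) , noMatching
      where
      srt : Sorted ⟪ c , w ⟫
      srt = ⟪⟫-sorted c w (λ { refl → w∉ (there c∈) })

      G″ : Graph n
      G″ = ⟪ c , w ⟫ ∷ e ∷ G

      inX : ∀ {x y} → Adj G″ x y → x ≢ c → y ≢ c → x ∈ X
      inX xy x≢c y≢c with Adj-⟪⟫∷⁻ c w xy
      ... | inj₂ (inj₁ (p , _)) = ⊥-elim (x≢c p)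
      ... | inj₂ (inj₂ (_ , p)) = ⊥-elim (y≢c p)
      ... | inj₁ xy′ with isE xy′
      ... | inj₂ (inj₁ (p , _)) = ⊥-elim (x≢c p)
      ... | inj₂ (inj₂ (_ , p)) = ⊥-elim (y≢c p)
      ... | inj₁ xy″ = proj₁ (Adj⇒Within win xy″)

      ⊆X : ∀ {L} → PM (Adj G″) L → c ∉ L → L ⊆ X
      ⊆X m c∉ x∈ with Adj-covers m x∈
      ... | y , y∈ , xy = inX xy (λ { refl → c∉ x∈ }) (λ { refl → c∉ y∈ })

      noMatching : ¬ HasMatching k G″
      noMatching h with matching⇒PM (srt ∷ Valid.sorted v) h
      ... | L , uL , mL , len with c ∈? L
      ... | no c∉ = <⇒≱ double<′ (≤-trans (≤-reflexive (sym len))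
                      (≤-trans (unique-⊆⇒length-≤ uL (⊆X mL c∉)) (≤-trans (≤-reflexive l) (n≤1+n _))))
      ... | yes c∈L with PM-mate (Adj-sym {G = G″}) mL c∈L
      ... | c′ , S , _ , π , mS with Unique-resp-↭ π uL
      ... | uS = <⇒≱ double<′ (≤-trans (≤-reflexive (trans (sym len) (↭-length π)))
                   (s≤s (≤-trans (unique-⊆⇒length-≤ (∷-unique c∉S (unique-tail (unique-tail uS))) sub) (≤-reflexive l))))
        where
        c∉S : c ∉ S
        c∉S z = unique-head uS (there z)
        sub : c ∷ S ⊆ X
        sub (here refl) = c∈
        sub (there z∈)  = ⊆X mS c∉S z∈

    Star-formed : ∀ {G X c d w e} → Covered G K X → c ∈ X → d ∉ X → w ∉ d ∷ X → Adj (e ∷ G) c d →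
                  Star k (⟪ c , w ⟫ ∷ e ∷ G)
    Star-formed {G} {X} {c} {d} {w} {e} (covered u l m win) c∈ d∉ w∉ cd
      with PM-mate (Adj-sym {G = G}) m c∈
    ... | c′ , R , cc′ , π , mR = record
        { unique = Unique-resp-↭ (↭-trans rotate₄ (↭-prep c (↭-prep c′ (↭-swap w d ↭-refl))))
                     (∷-unique w∉′ (∷-unique d∉′ (Unique-resp-↭ π u)))
        ; ax = up (up₀ cc′) ; ay = up cd ; az = Adj-⟪⟫ {G = ⟪ c , w ⟫ ∷ e ∷ G} (here refl)
        ; perfect = PM-map (λ p → up (up₀ p)) mR
        ; size = trans (cong (λ z → suc (suc z)) (trans (sym (↭-length π)) l)) (cong suc (sym (+-suc K K))) }
      where
      up₀ : ∀ {x y} → Adj G x y → Adj (e ∷ G) x y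
      up₀ = Adj-there {G = G}
      up : ∀ {x y} → Adj (e ∷ G) x y → Adj (⟪ c , w ⟫ ∷ e ∷ G) x y
      up = Adj-there {G = e ∷ G}
      d∉′ : d ∉ c ∷ c′ ∷ R
      d∉′ z = d∉ (∈-resp-↭ (↭-sym π) z)
      w∉′ : w ∉ d ∷ c ∷ c′ ∷ R
      w∉′ (here r)  = w∉ (here r)
      w∉′ (there z) = w∉ (there (∈-resp-↭ (↭-sym π) z))

    private
      t = n ∸ 1

    Star-wins : ∀ {G} p → Valid k G → Star k G → MaxForces k t p G
    Star-wins = MaxForces-any (Star k) (λ _ s _ → Star-∷ s)
      (λ v s T → dominating⇒length≥ (Star.a s) T (Star⇒Legal v s))

    Budget : ℕ → ℕ → Set
    Budget f m = tri n < f + m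

    Budget-∷ : ∀ {f m} → Budget (suc f) m → Budget f (suc m)
    Budget-∷ {f} b = ≤-trans b (≤-reflexive (sym (+-suc f _)))

    exhausted : ∀ {A : Set} {G : Graph n} → Valid k G → Budget 0 (length G) → A
    exhausted v b = ⊥-elim (<⇒≱ b (Valid⇒length≤ v))

    mutual

      -- Max is to move when the number of edges has the parity of `k`. This is what supplies a
      -- missing edge inside `X` once `X` is full.
      maxTurn : ∀ f {G j X} → Budget f (length G) → Valid k G → Covered G j X → j ≤ K →
                2 ∣ length G + k → MaxForces k t Max G
      maxTurn zero b v _ _ _ = exhausted v b
      maxTurn (suc f) {G} b v c j≤K even with m≤n⇒m<n∨m≡n j≤K
      ... | inj₁ j<K = let e , Y , l , c′ = newEdge v c j<K in
        maxMove e l (miniTurn f (Budget-∷ b) (Valid-∷ v l) c′ j<K (2∣-suc₂ even))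
      ... | inj₂ refl = let e , l , we = insideEdge v c even in
        maxMove e l (miniTurn f (Budget-∷ b) (Valid-∷ v l) (Covered-inside c we) ≤-refl (2∣-suc₂ even))

      miniTurn : ∀ f {G j X} → Budget f (length G) → Valid k G → Covered G j X → j ≤ K →
                 2 ∣ suc (length G + k) → MaxForces k t Mini G
      miniTurn zero b v _ _ _ = exhausted v b
      miniTurn (suc f) {G} {j} {X} b v c@(covered u l m win) j≤K odd = miniMove (notTerminal (m≤n⇒m<n∨m≡n j≤K)) reply
        where
        notTerminal : j < K ⊎ j ≡ K → ¬ Terminal k G
        notTerminal (inj₁ j<K) T = let e , _ , leg , _ = newEdge v c j<K in T e leg
        -- `X` is nonempty by `1≤K`, and one more vertex makes `2k − 1` vertices, too few for a
        -- `k`-matching.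
        notTerminal (inj₂ refl) T with inhabited X (≤-trans 1≤K (≤-trans (m≤m+n K K) (≤-reflexive (sym l))))
        ... | x , x∈ with fresh₁ {d = x} l ≤-refl
        ... | w , w∉ = T ⟪ x , w ⟫ (Within⇒Legal (⟪⟫-sorted x w (λ r → w∉ (here (sym r))))
            (∉-⟪⟫ x w (λ z → w∉ (there z)) win) (Valid.sorted v)
            (Within-⟪⟫ x w (there x∈) (here refl) ∷ All.map (Within-mono there) win)
            (≤-trans (s≤s (≤-reflexive (cong suc l))) double<′))

        -- This replies to an edge from `c₀` in `X` to `d` outside. While `X` is not full, `d` is
        -- paired with a new vertex and `X` grows by two; once it is full, a second edge leaving `X`
        -- at `c₀` creates the star.
        answer : ∀ f {e c₀ d} → Budget f (suc (length G)) → Legal k G e → c₀ ∈ X → d ∉ X →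
                 Within (d ∷ X) e → Adj (e ∷ G) c₀ d → IsEdge G e c₀ d → MaxForces k t Max (e ∷ G)
        answer zero b leg _ _ _ _ _ = exhausted (Valid-∷ v leg) b
        answer (suc f) {e} {c₀} {d} b leg c∈ d∉ we cd isE with fresh₁ {d = d} l j≤K | m≤n⇒m<n∨m≡n j≤K
        ... | w , w∉ | inj₂ refl =
          let leg′ = Legal-second (Valid-∷ v leg) c c∈ w∉ we isE in
          maxMove ⟪ c₀ , w ⟫ leg′ (Star-wins Mini (Valid-∷ (Valid-∷ v leg) leg′) (Star-formed c c∈ d∉ w∉ cd))
        ... | w , w∉ | inj₁ j<K =
          maxMove ⟪ d , w ⟫ leg′ (miniTurn f (Budget-∷ b) (Valid-∷ (Valid-∷ v leg) leg′)
            covered′ j<K (2∣-suc₂ odd))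
          where
          win′ : All (Within (w ∷ d ∷ X)) (⟪ d , w ⟫ ∷ e ∷ G)
          win′ = Within-⟪⟫ d w (there (here refl)) (here refl) ∷ Within-mono there we
                 ∷ All.map (Within-mono (λ z → there (there z))) win
          leg′ : Legal k (e ∷ G) ⟪ d , w ⟫
          leg′ = Within⇒Legal (⟪⟫-sorted d w (λ r → w∉ (here (sym r))))
            (∉-⟪⟫ d w w∉ (we ∷ All.map (Within-mono there) win))
            (Valid.sorted (Valid-∷ v leg)) win′
            (≤-trans (s≤s (≤-reflexive (cong (λ z → suc (suc z)) l))) (double< j<K))
          covered′ : Covered (⟪ d , w ⟫ ∷ e ∷ G) (suc j) (w ∷ d ∷ X)
          covered′ = covered (∷-unique w∉ (∷-unique d∉ u))
            (trans (cong (λ z → suc (suc z)) l) (cong suc (sym (+-suc j j))))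
            (PM-∷∷ (Adj-sym {G = ⟪ d , w ⟫ ∷ e ∷ G} (Adj-⟪⟫ {G = ⟪ d , w ⟫ ∷ e ∷ G} (here refl)))
              (PM-map (λ p → Adj-there {G = e ∷ G} (Adj-there {G = G} p)) m)) win′

        x∉y∷X : ∀ {x y} → Legal k G (x , y) → x ∉ X → x ∉ y ∷ X
        x∉y∷X leg x∉ (here refl) = 1+n≰n (proj₁ leg)
        x∉y∷X leg x∉ (there z)   = x∉ z

        reply : ∀ e → Legal k G e → MaxForces k t Max (e ∷ G)
        reply e@(x , y) leg with x ∈? X | y ∈? X
        ... | yes x∈ | yes y∈ = maxTurn f (Budget-∷ b) (Valid-∷ v leg) (Covered-inside c (x∈ , y∈)) j≤K odd
        ... | yes x∈ | no y∉  = answer f (Budget-∷ b) leg x∈ y∉ (there x∈ , here refl) (inj₁ (here refl)) (Adj-∷⁻ {G = G})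
        ... | no x∉  | yes y∈ = answer f (Budget-∷ b) leg y∈ x∉ (here refl , there y∈) (inj₂ (here refl))
                                  (λ p → +edge-swap {E = Adj G} (Adj-∷⁻ {G = G} p))
        ... | no x∉  | no y∉ with m≤n⇒m<n∨m≡n j≤K
        ... | inj₁ j<K = maxTurn f (Budget-∷ b) (Valid-∷ v leg)
            (Covered-new c (x∉y∷X leg x∉) y∉ (inj₁ (here refl))
              ((here refl , there (here refl)) ∷ All.map (Within-mono (λ z → there (there z))) win)) j<K odd
        -- An edge disjoint from a full `X` would complete a `k`-matching.
        ... | inj₂ refl = ⊥-elim (proj₂ (proj₂ leg) (PM⇒matching (∷-unique (x∉y∷X leg x∉) (∷-unique y∉ u))
            (PM-∷∷ (inj₁ (here refl)) (PM-map (Adj-there {G = G}) m))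
            (trans (cong (λ z → suc (suc z)) l) (cong suc (sym (+-suc K K))))))

  -- Lower bounds for the score

  Covered-[] : Covered [] 0 []
  Covered-[] = covered [] refl [] []

  score≥-Max-first : ∀ {k} → 2 ≤ k → 2 ∣ k → ScoreAtLeast n k Max (n ∸ 1)
  score≥-Max-first {suc K} 2≤k even with suc K + suc K ≤? n
  ... | no ¬p = Max-small Max (<⇒≤ 2≤k) (≰⇒> ¬p)
  ... | yes p = MaxStrategy.maxTurn K (s≤s⁻¹ 2≤k) p (suc (tri n)) (s≤s (m≤m+n _ _))
                  (Valid-[] (<⇒≤ 2≤k)) Covered-[] z≤n even

  score≥-Mini-first : ∀ {k} → 2 ≤ k → ¬ 2 ∣ k → ScoreAtLeast n k Mini (n ∸ 1)
  score≥-Mini-first {suc K} 2≤k odd with suc K + suc K ≤? n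
  ... | no ¬p = Max-small Mini (<⇒≤ 2≤k) (≰⇒> ¬p)
  ... | yes p = MaxStrategy.miniTurn K (s≤s⁻¹ 2≤k) p (suc (tri n)) (s≤s (m≤m+n _ _))
                  (Valid-[] (<⇒≤ 2≤k)) Covered-[] z≤n (¬2∣⇒2∣suc _ odd)

  -- Families of parts and their matching number

  Parts : Set
  Parts = List (List (Fin n))

  -- For disjoint parts, the largest size of a matching when every part is a complete graph.
  ν : Parts → ℕ
  ν []      = 0
  ν (X ∷ P) = ⌊ length X /2⌋ + ν P

  ν-↭ : ∀ {P Q} → P ↭ Q → ν P ≡ ν Q
  ν-↭ refl         = refl
  ν-↭ (prep X π)   = cong (⌊ length X /2⌋ +_) (ν-↭ π)
  ν-↭ (swap {xs = P} X Y π) =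
    trans (swap+ ⌊ length X /2⌋ ⌊ length Y /2⌋ (ν P)) (cong (λ z → ⌊ length Y /2⌋ + (⌊ length X /2⌋ + z)) (ν-↭ π))
    where
    swap+ : ∀ a b c → a + (b + c) ≡ b + (a + c)
    swap+ = solve-∀
  ν-↭ (↭.trans π ρ)  = trans (ν-↭ π) (ν-↭ ρ)

  InPart : Parts → Edge n → Set
  InPart P e = Any (λ X → Within X e) P

  SameIn : Parts → Fin n → Fin n → Set
  SameIn P a b = InPart P (a , b)

  SameIn-sym : ∀ {P a b} → SameIn P a b → SameIn P b a
  SameIn-sym (here (p , q)) = here (q , p)
  SameIn-sym (there s)      = there (SameIn-sym s)

  Adj⇒SameIn : ∀ {G P} → All (InPart P) G → ∀ {a b} → Adj G a b → SameIn P a b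
  Adj⇒SameIn i (inj₁ p) = All.lookup i p
  Adj⇒SameIn i (inj₂ p) = SameIn-sym (All.lookup i p)

  PM-split : ∀ {X P L} → PM (SameIn (X ∷ P)) L →
             ∃₂ λ L₁ L₂ → L ↭ L₁ ++ L₂ × L₁ ⊆ X × (∃ λ h → length L₁ ≡ h + h) × PM (SameIn P) L₂
  PM-split [] = [] , [] , refl , (λ ()) , (0 , refl) , []
  PM-split (pair {a} {b} e m π) with PM-split m
  PM-split (pair {a} {b} (here (a∈ , b∈)) m π) | L₁ , L₂ , ρ , s , (h , eq) , m₂ =
    a ∷ b ∷ L₁ , L₂ , ↭-trans π (↭-prep a (↭-prep b ρ)) ,
    (λ { (here refl) → a∈ ; (there (here refl)) → b∈ ; (there (there z)) → s z }) ,
    (suc h , cong suc (trans (cong suc eq) (sym (+-suc h h)))) , m₂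
  PM-split (pair {a} {b} (there e) m π) | L₁ , L₂ , ρ , s , ev , m₂ =
    L₁ , a ∷ b ∷ L₂ , ↭-trans π (↭-trans (↭-prep a (↭-prep b ρ)) (shifts (a ∷ b ∷ []) L₁)) , s , ev , PM-∷∷ e m₂

  -- The pairs inside one part cover an even number of its vertices, hence at most twice its rounded
  -- half.
  PM⇒length≤ : ∀ P {L} → Unique L → PM (SameIn P) L → length L ≤ ν P + ν P
  PM⇒length≤ []      u []            = z≤n
  PM⇒length≤ []      u (pair () _ _)
  PM⇒length≤ (X ∷ P) {L} u m with PM-split m
  ... | L₁ , L₂ , π , s , (h , eq) , m₂ = begin
      length L                   ≡⟨ trans (↭-length π) (length-++ L₁) ⟩
      length L₁ + length L₂      ≤⟨ +-mono-≤ (subst (_≤ x + x) (sym eq) (+-mono-≤ h≤ h≤)) (PM⇒length≤ P (unique-++ʳ L₁ u′) m₂) ⟩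
      (x + x) + (ν P + ν P)      ≡⟨ double-+ x (ν P) ⟩
      (x + ν P) + (x + ν P)      ∎
    where
    open ≤-Reasoning
    x = ⌊ length X /2⌋
    u′ : Unique (L₁ ++ L₂)
    u′ = Unique-resp-↭ π u
    h≤ : h ≤ x
    h≤ = subst (_≤ x) (sym (n≡⌊n+n/2⌋ h))
           (⌊n/2⌋-mono (subst (_≤ length X) eq (unique-⊆⇒length-≤ (unique-++ˡ L₁ u′) s)))

  InPart⇒¬matching : ∀ {k G P} → All Sorted G → All (InPart P) G → ν P < k → ¬ HasMatching k G
  InPart⇒¬matching {k} {G} {P} s i lt h with matching⇒PM s h
  ... | L , u , m , len =
    <⇒≱ lt (double-≤⁻ (subst (_≤ ν P + ν P) len (PM⇒length≤ P u (PM-map (Adj⇒SameIn i) m))))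

  InPart⇒Legal : ∀ {k G P e} → Sorted e → e ∉ G → All Sorted G → All (InPart P) (e ∷ G) → ν P < k → Legal k G e
  InPart⇒Legal se e∉ s i lt = se , e∉ , InPart⇒¬matching (se ∷ s) i lt

  inner : Parts → List (Edge n)
  inner []      = []
  inner (X ∷ P) = pairs X ++ inner P

  length-inner : ∀ X P → length (inner (X ∷ P)) ≡ tri (length X) + length (inner P)
  length-inner X P = trans (length-++ (pairs X)) (cong (_+ length (inner P)) (length-pairs X))

  -- Each part is bounded by a clique of odd size with the same half; odd cliques are then merged
  -- one by one, keeping the sum of the halves.
  inner-bound : ∀ P → length (inner P) ≤ tri (suc (ν P + ν P))
  inner-bound []      = z≤n
  inner-bound (X ∷ P) = begin
      length (inner (X ∷ P))                          ≡⟨ length-inner X P ⟩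
      tri (length X) + length (inner P)               ≤⟨ +-mono-≤ (tri-bound (length X)) (inner-bound P) ⟩
      tri (suc (x + x)) + tri (suc (ν P + ν P))       ≤⟨ tri-superadditive x (ν P) ⟩
      tri (suc (ν (X ∷ P) + ν (X ∷ P)))               ∎
    where
    open ≤-Reasoning
    x = ⌊ length X /2⌋

  inner-parity : ∀ P → 2 ∣ length (inner P) + ν P
  inner-parity []      = divides 0 refl
  inner-parity (X ∷ P) = subst (2 ∣_)
    (trans (interchange (tri (length X)) ⌊ length X /2⌋ (length (inner P)) (ν P))
      (cong (_+ ν (X ∷ P)) (sym (length-inner X P))))
    (∣m∣n⇒∣m+n (tri-parity (length X)) (inner-parity P))
    where
    interchange : ∀ a b c d → (a + b) + (c + d) ≡ (a + c) + (b + d)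
    interchange = solve-∀

  ∈-inner⁺ : ∀ {P e} → Sorted e → InPart P e → e ∈ inner P
  ∈-inner⁺ s (here (p , q))      = ∈-++⁺ˡ (∈-pairs⁺ p q s)
  ∈-inner⁺ {X ∷ P} s (there i) = ∈-++⁺ʳ (pairs X) (∈-inner⁺ s i)

  ∈-inner⁻ : ∀ P {e} → Unique (concat P) → e ∈ inner P → Sorted e × InPart P e
  ∈-inner⁻ (X ∷ P) u e∈ with ∈-++⁻ (pairs X) e∈
  ... | inj₁ p = let s , w = ∈-pairs⁻ (unique-++ˡ X u) p in s , here w
  ... | inj₂ p = let s , i = ∈-inner⁻ P (unique-++ʳ X u) p in s , there i

  InPart⇒∈concat : ∀ {P a b} → SameIn P a b → a ∈ concat P
  InPart⇒∈concat (here (p , _)) = ∈-++⁺ˡ p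
  InPart⇒∈concat {X ∷ P} (there i) = ∈-++⁺ʳ X (InPart⇒∈concat i)

  inner-unique : ∀ P → Unique (concat P) → Unique (inner P)
  inner-unique []      u = []
  inner-unique (X ∷ P) u = Uniqueₚ.++⁺ (pairs-unique (unique-++ˡ X u)) (inner-unique P (unique-++ʳ X u))
    λ (p , q) → unique-++-disjoint X u (proj₁ (proj₂ (∈-pairs⁻ (unique-++ˡ X u) p)))
                  (InPart⇒∈concat {P} (proj₂ (∈-inner⁻ P (unique-++ʳ X u) q)))

  InPart⇒length≤ : ∀ {G P} → Unique G → All Sorted G → All (InPart P) G → length G ≤ length (inner P)
  InPart⇒length≤ u s i = unique-⊆⇒length-≤ u λ e∈ → ∈-inner⁺ (All.lookup s e∈) (All.lookup i e∈)

  Part : Graph n → List (Fin n) → Set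
  Part G X = FactorCritical (Adj G) X ⊎ Linkable (Adj G) X

  Part-∷ : ∀ {G e X} → Part G X → Part (e ∷ G) X
  Part-∷ {G} = map-⊎ (FactorCritical-map (Adj-there {G = G})) (Linkable-map (Adj-there {G = G}))

  FactorCritical-odd : ∀ {E : Fin n → Fin n → Set} {A} → FactorCritical E A → ∃ λ h → length A ≡ suc (h + h)
  FactorCritical-odd (fc r m) = let R , π , p = m r ; h , eq = PM-even p in h , trans (↭-length π) (cong suc eq)

  -- Decompositions of the vertex set into factor-critical and linkable parts

  record Decomposition (G : Graph n) (P : Parts) : Set where
    constructor decomposition
    field
      cover  : concat P ↭ allFin n
      inside : All (InPart P) G
      parts  : All (Part G) P

    unique : Unique (concat P)
    unique = Unique-resp-↭ (↭-sym cover) (Uniqueₚ.allFin⁺ n)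

  open Decomposition

  Decomposition-↭ : ∀ {G P Q} → P ↭ Q → Decomposition G P → Decomposition G Q
  Decomposition-↭ π (decomposition c i p) =
    decomposition (↭-trans (↭-sym (concat-↭ π)) c) (All.map (Any-resp-↭ π) i) (All-resp-↭ π p)

  Decomposition-∷ : ∀ {G P e} → InPart P e → Decomposition G P → Decomposition (e ∷ G) P
  Decomposition-∷ ie (decomposition c i p) = decomposition c (ie ∷ i) (All.map Part-∷ p)

  InPart-merge : ∀ {A B P e} → InPart (A ∷ B ∷ P) e → InPart ((A ++ B) ∷ P) e
  InPart-merge (here (p , q))             = here (∈-++⁺ˡ p , ∈-++⁺ˡ q)
  InPart-merge {A} (there (here (p , q))) = here (∈-++⁺ʳ A p , ∈-++⁺ʳ A q)
  InPart-merge (there (there i))          = there i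

  Decomposition-merge : ∀ {G A B P e} → Decomposition G (A ∷ B ∷ P) → Within (A ++ B) e → Part (e ∷ G) (A ++ B) →
                        Decomposition (e ∷ G) ((A ++ B) ∷ P)
  Decomposition-merge {A = A} {B} {P} (decomposition c i (_ ∷ _ ∷ p)) w x =
    decomposition (↭-trans (↭-reflexive (++-assoc A B (concat P))) c)
      (here w ∷ All.map InPart-merge i) (x ∷ All.map Part-∷ p)

  -- Linkable parts contribute perfect matchings, factor-critical ones a matching that misses the
  -- root, and `S` collects the roots. So `ν P` is attained in `G` itself, not only in the union of
  -- cliques.
  Decomposition-matching : ∀ {G P} → Decomposition G P → HasMatching (ν P) G
  Decomposition-matching {G} {P} d =
    let L , S , π , m , len = collect P (parts d)
    in PM⇒matching (unique-++ˡ L (Unique-resp-↭ π (unique d))) m len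
    where
    collect : ∀ P → All (Part G) P → ∃₂ λ L S → concat P ↭ L ++ S × PM (Adj G) L × length L ≡ ν P + ν P
    collect [] [] = [] , [] , refl , [] , refl
    collect (X ∷ P) (inj₂ (lk m _) ∷ ps) =
      let L , S , π , mL , len = collect P ps ; h , eq = PM-even m in
      X ++ L , S , ↭-trans (++⁺ˡ X π) (↭-reflexive (sym (++-assoc X L S))) , PM-++ m mL ,
      trans (length-++ X) (trans (cong₂ _+_ (trans eq (cong (λ z → z + z) (trans (n≡⌊n+n/2⌋ h) (cong ⌊_/2⌋ (sym eq))))) len)
        (double-+ ⌊ length X /2⌋ (ν P)))
    collect (X ∷ P) (inj₁ f@(fc r minus) ∷ ps) =
      let L , S , π , mL , len = collect P ps ; R , ρ , m = minus r ; h , eq = PM-even m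
          eq′ = trans (↭-length ρ) (cong suc eq) in
      R ++ L , _ ∷ S ,
      ↭-trans (++⁺ ρ π) (↭-trans (↭-prep _ (↭-reflexive (sym (++-assoc R L S)))) (↭-sym (shift _ (R ++ L) S))) ,
      PM-++ m mL ,
      trans (length-++ R) (trans (cong₂ _+_ (trans eq (cong (λ z → z + z) (trans (n≡⌈n+n/2⌉ h) (cong ⌊_/2⌋ (sym eq′))))) len)
        (double-+ ⌊ length X /2⌋ (ν P)))

  ¬Adj-cross : ∀ {G A B P a b} → Decomposition G (A ∷ B ∷ P) → a ∈ A → b ∈ B → ¬ Adj G a b
  ¬Adj-cross {A = A} {B} d a∈ b∈ ab with Adj⇒SameIn (inside d) ab
  ... | here (_ , b∈A)         = unique-++-disjoint A (unique d) b∈A (∈-++⁺ˡ b∈)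
  ... | there (here (a∈B , _)) = unique-++-disjoint A (unique d) a∈ (∈-++⁺ˡ a∈B)
  ... | there (there s)        = unique-++-disjoint A (unique d) a∈ (∈-++⁺ʳ B (InPart⇒∈concat s))

  cross-≢ : ∀ {G A B P a b} → Decomposition G (A ∷ B ∷ P) → a ∈ A → b ∈ B → a ≢ b
  cross-≢ {A = A} d a∈ b∈ refl = unique-++-disjoint A (unique d) a∈ (∈-++⁺ˡ b∈)

  ν-merge-even : ∀ {E : Fin n → Fin n → Set} D B P → PM E D → ν ((D ++ B) ∷ P) ≡ ν (D ∷ B ∷ P)
  ν-merge-even D B P m with PM-even m
  ... | h , eq rewrite length-++ D {B} | eq | half-even h (length B) | sym (n≡⌊n+n/2⌋ h) = +-assoc h _ _

  ν-merge-evenʳ : ∀ {E : Fin n → Fin n → Set} A D P → PM E D → ν ((A ++ D) ∷ P) ≡ ν (A ∷ D ∷ P)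
  ν-merge-evenʳ A D P m = trans (cong (λ z → ⌊ z /2⌋ + ν P) (↭-length (++-comm A D)))
    (trans (ν-merge-even D A P m) (ν-↭ {D ∷ A ∷ P} (swap D A refl)))

  -- Each odd part has one vertex left over, and the merged part has room to pair these two.
  ν-merge-odd : ∀ {E : Fin n → Fin n → Set} A B P → FactorCritical E A → FactorCritical E B →
                ν ((A ++ B) ∷ P) ≡ suc (ν (A ∷ B ∷ P))
  ν-merge-odd A B P fA fB with FactorCritical-odd fA | FactorCritical-odd fB
  ... | g , eg | h , eh rewrite length-++ A {B} | eg | eh | +-suc (g + g) (h + h) | half-even g (h + h)
        | sym (n≡⌊n+n/2⌋ h) | sym (n≡⌈n+n/2⌉ g) | sym (n≡⌈n+n/2⌉ h) = cong suc (+-assoc g h _)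

  -- Apply linkedness to `d` itself: the first alternative would need `d` twice in `D`, and the
  -- second exhibits `d′` beside `d`.
  Linked-end : ∀ {E : Fin n → Fin n → Set} {D d d′} → Unique D → d ∈ D → Linked E D d d′ → d′ ∈ D × d ≢ d′
  Linked-end u d∈ l with l d∈
  ... | inj₁ (_ , π , _) = ⊥-elim (unique-head (Unique-resp-↭ π u) (here refl))
  ... | inj₂ (_ , π , _) = ∈-resp-↭ (↭-sym π) (there (here refl)) ,
                           (λ { refl → unique-head (Unique-resp-↭ π u) (here refl) })

  findPart : ∀ {G P a} → Decomposition G P → ∃₂ λ A Q → a ∈ A × P ↭ A ∷ Q
  findPart {P = P} {a} d with ∈-concat⁻′ P (∈-resp-↭ (↭-sym (cover d)) (∈-allFin a))
  ... | A , a∈ , A∈ = let Q , π = extract A∈ in A , Q , a∈ , π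

  -- Linkable parts are even, so if all parts were linkable they would have only `ν P + ν P`
  -- vertices together.
  odd-part : ∀ {G} P → All (Part G) P → ν P + ν P < length (concat P) →
             ∃₂ λ A Q → P ↭ A ∷ Q × FactorCritical (Adj G) A
  odd-part (X ∷ P) (inj₁ f ∷ _)         lt = X , P , refl , f
  odd-part (X ∷ P) (inj₂ (lk m _) ∷ ps) lt with PM-even m
  ... | h , eq rewrite length-++ X {concat P} | eq | sym (n≡⌊n+n/2⌋ h)
    with odd-part P ps (+-cancelˡ-≤ (h + h) _ _ (≤-trans (≤-reflexive (rearrange h (ν P))) lt))
    where
    rearrange : ∀ h v → (h + h) + suc (v + v) ≡ suc ((h + v) + (h + v))
    rearrange = solve-∀
  ... | A , Q , π , f = A , X ∷ Q , ↭-trans (↭-prep X π) (↭-swap X A refl) , f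

  -- Removing an odd part of `2h + 1` vertices lowers `ν` by `h`, so the surplus of vertices over
  -- `2ν` drops only by one, from at least two, and a second odd part exists.
  two-odd-parts : ∀ {G} P → All (Part G) P → suc (ν P + ν P) < length (concat P) →
                  ∃₂ λ A B → ∃ λ Q → P ↭ A ∷ B ∷ Q × FactorCritical (Adj G) A × FactorCritical (Adj G) B
  two-odd-parts P ps lt with odd-part P ps (<⇒≤ lt)
  ... | A , Q , π , f with FactorCritical-odd f | All-resp-↭ π ps
  ... | h , eq | _ ∷ qs with odd-part Q qs (+-cancelˡ-≤ (suc (h + h)) _ _ bound)
    where
    rearrange : ∀ h v → suc (h + h) + suc (v + v) ≡ suc (suc ((h + v) + (h + v)))
    rearrange = solve-∀
    νP : ν P ≡ h + ν Q
    νP = trans (ν-↭ π) (cong (_+ ν Q) (trans (cong ⌊_/2⌋ eq) (sym (n≡⌈n+n/2⌉ h))))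
    bound : suc (h + h) + suc (ν Q + ν Q) ≤ suc (h + h) + length (concat Q)
    bound = ≤-trans (≤-reflexive (trans (rearrange h (ν Q)) (cong (λ z → suc (suc (z + z))) (sym νP))))
      (≤-trans lt (≤-reflexive (trans (↭-length (concat-↭ π)) (trans (length-++ A) (cong (_+ length (concat Q)) eq)))))
  ... | B , S , ρ , g = A , B , S , ↭-trans π (↭-prep A ρ) , f , g

  -- Mini's strategy

  module MiniStrategy (k : ℕ) (2k≤n : k + k ≤ n) where

    -- With `ν P < k` all parts may be filled up to cliques without creating a `k`-matching, so
    -- every missing edge inside a part is legal.
    record Safe (G : Graph n) : Set where
      constructor safe
      field
        {P}   : Parts
        dec   : Decomposition G P
        small : ν P < k

    FreeMove : Graph n → Set
    FreeMove G = ∃ λ e → Legal k G e × Safe (e ∷ G)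

    -- If all parts are cliques, the number of edges has the parity of `ν P`; by hypothesis it also
    -- has that of `k`, so `ν P` is at most `k − 2`. As `k + k ≤ n`, there are two odd parts, and
    -- joining them raises `ν` by just one.
    freeMove : ∀ {G} → Valid k G → Safe G → 2 ∣ length G + k → FreeMove G
    freeMove {G} v (safe {P} d small) even with All.all? (_∈ᵉ? G) (inner P)
    ... | no ¬all with find (¬All⇒Any¬ (_∈ᵉ? G) (inner P) ¬all)
    ... | e , e∈ , e∉ = let s , i = ∈-inner⁻ P (unique d) e∈ in
      e , InPart⇒Legal s e∉ (Valid.sorted v) (i ∷ inside d) small , safe (Decomposition-∷ i d) small
    freeMove {G} v (safe {P} d small) even | yes all = join (two-odd-parts P (parts d) room)
      where
      full : length G ≡ length (inner P)
      full = ≤-antisym (InPart⇒length≤ (Valid.unique v) (Valid.sorted v) (inside d))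
                       (unique-⊆⇒length-≤ (inner-unique P (unique d)) (All.lookup all))
      suc-small : suc (ν P) < k
      suc-small = ≤∧≢⇒< small λ { refl → ¬2∣-both (inner-parity P)
        (subst (2 ∣_) (trans (+-suc (length G) (ν P)) (cong (λ z → suc (z + ν P)) full)) even) }
      room : suc (ν P + ν P) < length (concat P)
      room = ≤-trans (≤-trans (s≤s (≤-reflexive (sym (+-suc (ν P) (ν P))))) (+-mono-≤ small small))
               (≤-trans 2k≤n (≤-reflexive (trans (sym ∣allFin∣) (sym (↭-length (cover d))))))
      join : _ → FreeMove G
      join (A , B , Q , π , fA , fB) = ⟪ a , b ⟫ ,
          InPart⇒Legal (⟪⟫-sorted a b (cross-≢ d′ a∈ b∈)) (λ p → ¬Adj-cross d′ a∈ b∈ (Adj-⟪⟫ {G = G} p))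
            (Valid.sorted v) (inside d″) ν< ,
          safe d″ ν<
        where
        a = FactorCritical.root fA
        b = FactorCritical.root fB
        a∈ = FactorCritical.root∈ fA
        b∈ = FactorCritical.root∈ fB
        d′ : Decomposition G (A ∷ B ∷ Q)
        d′ = Decomposition-↭ π d
        up : ∀ {x y} → Adj G x y → Adj (⟪ a , b ⟫ ∷ G) x y
        up = Adj-there {G = G}
        d″ : Decomposition (⟪ a , b ⟫ ∷ G) ((A ++ B) ∷ Q)
        d″ = Decomposition-merge d′ (Within-⟪⟫ a b (∈-++⁺ˡ a∈) (∈-++⁺ʳ A b∈))
               (inj₂ (FactorCritical-join (FactorCritical-map up fA) (FactorCritical-map up fB) a∈ b∈
                       (Adj-⟪⟫ {G = ⟪ a , b ⟫ ∷ G} (here refl))))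
        ν< : ν ((A ++ B) ∷ Q) < k
        ν< = subst (_< k) (sym (trans (ν-merge-odd A B Q fA fB) (cong suc (sym (ν-↭ π))))) suc-small

    -- After Max's edge e Mini either still has a free choice of move or must reply at once.
    Answer : Graph n → Edge n → Set
    Answer G e = Safe (e ∷ G) ⊎ FreeMove (e ∷ G)

    module _ {G : Graph n} {e : Edge n} (v : Valid k (e ∷ G)) where

      private
        up : ∀ {x y} → Adj G x y → Adj (e ∷ G) x y
        up = Adj-there {G = G}

      -- Max's edge raises `ν` by one. It stays below `k` because the merged decomposition has a
      -- matching of size `ν`, while the position reached by a legal move has none of size `k`.
      joined : ∀ {A B P a b} → Decomposition G (A ∷ B ∷ P) → ν (A ∷ B ∷ P) < k →
               FactorCritical (Adj G) A → FactorCritical (Adj G) B → a ∈ A → b ∈ B →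
               Adj (e ∷ G) a b → Within (A ++ B) e → Safe (e ∷ G)
      joined {A} {B} {P} d small fA fB a∈ b∈ ab w =
        safe d′ (≤∧≢⇒< (subst (_≤ k) (sym (ν-merge-odd A B P fA fB)) small)
                  λ eq → Valid.free v (subst (λ j → HasMatching j (e ∷ G)) eq (Decomposition-matching d′)))
        where
        d′ : Decomposition (e ∷ G) ((A ++ B) ∷ P)
        d′ = Decomposition-merge d w
               (inj₂ (FactorCritical-join (FactorCritical-map up fA) (FactorCritical-map up fB) a∈ b∈ ab))

      -- After `e` alone the merged set need be neither factor-critical nor linkable, so `part` is
      -- asked for only with the second edge from `x` to `y` in place.
      reply : ∀ {A B P x y} → Decomposition G (A ∷ B ∷ P) → ν ((A ++ B) ∷ P) < k → Within (A ++ B) e →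
              x ∈ A → y ∈ B → ¬ Adj (e ∷ G) x y → Part (⟪ x , y ⟫ ∷ e ∷ G) (A ++ B) → FreeMove (e ∷ G)
      reply {A} {B} {P} {x} {y} d@(decomposition c i (_ ∷ _ ∷ p)) small w x∈ y∈ ¬xy part =
        ⟪ x , y ⟫ ,
        InPart⇒Legal (⟪⟫-sorted x y (cross-≢ d x∈ y∈)) (λ q → ¬xy (Adj-⟪⟫ {G = e ∷ G} q))
          (Valid.sorted v) (inside d″) small ,
        safe d″ small
        where
        d″ : Decomposition (⟪ x , y ⟫ ∷ e ∷ G) ((A ++ B) ∷ P)
        d″ = decomposition (↭-trans (↭-reflexive (++-assoc A B (concat P))) c)
          (here (Within-⟪⟫ x y (∈-++⁺ˡ x∈) (∈-++⁺ʳ A y∈)) ∷ here w ∷ All.map InPart-merge i)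
          (part ∷ All.map (λ q → Part-∷ (Part-∷ q)) p)

      private
        up₂ : ∀ {x y} f → Adj G x y → Adj (f ∷ e ∷ G) x y
        up₂ f q = Adj-there {G = e ∷ G} (up q)

        unique₂ : ∀ {A B P} → Decomposition G (A ∷ B ∷ P) → Unique B
        unique₂ {A} {B} d = unique-++ˡ B (unique-++ʳ A (unique d))

      -- Mini joins `a` to the partner `d′` of `d`, closing an ear through `D`. Max's edge is the
      -- only one between `A` and `D`, and `d′` differs from `d`, so the reply is a new edge.
      ear : ∀ {A D P a d} → Decomposition G (A ∷ D ∷ P) → ν (A ∷ D ∷ P) < k →
            FactorCritical (Adj G) A → Linkable (Adj G) D → a ∈ A → d ∈ D →
            Adj (e ∷ G) a d → IsEdge G e a d → Within (A ++ D) e → FreeMove (e ∷ G)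
      ear {A} {D} {P} {a} {d} dec small fA lD a∈ d∈ ad isE w with Linkable.link lD d∈
      ... | d′ , l with Linked-end (unique₂ dec) d∈ l
      ... | d′∈ , d≢d′ = reply dec (subst (_< k) (sym (ν-merge-evenʳ A D P (Linkable.perfect lD))) small) w a∈ d′∈ ¬ad′
          (inj₁ (FactorCritical-ear (FactorCritical-map (up₂ f) fA) (Linkable-map (up₂ f) lD) a∈ (Linked-map (up₂ f) l)
            (Adj-there {G = e ∷ G} ad) (Adj-⟪⟫ {G = f ∷ e ∷ G} (here refl))))
        where
        f = ⟪ a , d′ ⟫
        ¬ad′ : ¬ Adj (e ∷ G) a d′
        ¬ad′ q with isE q
        ... | inj₁ r                 = ¬Adj-cross dec a∈ d′∈ r
        ... | inj₂ (inj₁ (_ , r))    = d≢d′ (sym r)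
        ... | inj₂ (inj₂ (r , _))    = cross-≢ dec a∈ d∈ r

      -- Mini joins the partners of the two ends of Max's edge. `D` has even size, so merging leaves
      -- `ν` unchanged.
      link : ∀ {D F P d f} → Decomposition G (D ∷ F ∷ P) → ν (D ∷ F ∷ P) < k →
             Linkable (Adj G) D → Linkable (Adj G) F → d ∈ D → f ∈ F →
             Adj (e ∷ G) d f → IsEdge G e d f → Within (D ++ F) e → FreeMove (e ∷ G)
      link {D} {F} {P} {d} {f} dec small lD lF d∈ f∈ df isE w with Linkable.link lD d∈ | Linkable.link lF f∈
      ... | d′ , l | f′ , m with Linked-end (unique-++ˡ D (unique dec)) d∈ l | Linked-end (unique₂ dec) f∈ m
      ... | d′∈ , d≢d′ | f′∈ , _ =
          reply dec (subst (_< k) (sym (ν-merge-even D F P (Linkable.perfect lD))) small) w d′∈ f′∈ ¬d′f′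
          (inj₂ (Linkable-join (Adj-sym {G = g ∷ e ∷ G}) (Linkable-map (up₂ g) lD) (Linkable-map (up₂ g) lF) d∈ d′∈ f∈ f′∈
            (Linked-map (up₂ g) l) (Linked-map (up₂ g) m)
            (Adj-there {G = e ∷ G} df) (Adj-⟪⟫ {G = g ∷ e ∷ G} (here refl))))
        where
        g = ⟪ d′ , f′ ⟫
        ¬d′f′ : ¬ Adj (e ∷ G) d′ f′
        ¬d′f′ q with isE q
        ... | inj₁ r                 = ¬Adj-cross dec d′∈ f′∈ r
        ... | inj₂ (inj₁ (r , _))    = d≢d′ (sym r)
        ... | inj₂ (inj₂ (r , _))    = cross-≢ dec d′∈ f∈ r

      answer-across : ∀ {A B P a b} → Decomposition G (A ∷ B ∷ P) → ν (A ∷ B ∷ P) < k → a ∈ A → b ∈ B →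
                      Adj (e ∷ G) a b → IsEdge G e a b → Within (A ++ B) e → Answer G e
      answer-across {A} {B} {P} dec@(decomposition _ _ (pA ∷ pB ∷ _)) small a∈ b∈ ab isE w with pA | pB
      ... | inj₁ fA | inj₁ fB = inj₁ (joined dec small fA fB a∈ b∈ ab w)
      ... | inj₁ fA | inj₂ lB = inj₂ (ear dec small fA lB a∈ b∈ ab isE w)
      ... | inj₂ lA | inj₂ lB = inj₂ (link dec small lA lB a∈ b∈ ab isE w)
      ... | inj₂ lA | inj₁ fB = inj₂ (ear (Decomposition-↭ (↭-swap A B refl) dec)
              (subst (_< k) (ν-↭ {A ∷ B ∷ P} (↭-swap A B refl)) small) fB lA b∈ a∈
              (Adj-sym {G = e ∷ G} ab) (λ q → +edge-swap {E = Adj G} (isE q))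
              (Within-mono (∈-resp-↭ (++-comm A B)) w))

    answer : ∀ {G e} → Valid k G → Safe G → Legal k G e → Answer G e
    answer {G} {a , b} v (safe {P} d small) leg with findPart {a = a} d
    ... | A , Q , a∈ , π with b ∈? A | findPart {a = b} d
    ... | yes b∈ | _ = inj₁ (safe (Decomposition-∷ (here (a∈ , b∈)) (Decomposition-↭ π d)) (subst (_< k) (ν-↭ π) small))
    ... | no b∉ | B , Q′ , b∈ , π′ with ∈-resp-↭ π (∈-resp-↭ (↭-sym π′) (here refl))
    ... | here refl = ⊥-elim (b∉ b∈)
    ... | there B∈Q with extract B∈Q
    ... | S , ρ = answer-across (Valid-∷ v leg) (Decomposition-↭ π″ d) (subst (_< k) (ν-↭ π″) small) a∈ b∈
            (inj₁ (here refl)) (Adj-∷⁻ {G = G}) (∈-++⁺ˡ a∈ , ∈-++⁺ʳ A b∈)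
      where
      π″ : P ↭ A ∷ B ∷ S
      π″ = ↭-trans π (↭-prep A ρ)

    private
      t = tri (k + k ∸ 1)

    Safe-bound : ∀ {G} → Valid k G → Safe G → length G ≤ t
    Safe-bound v (safe {P} d small) =
      ≤-trans (InPart⇒length≤ (Valid.unique v) (Valid.sorted v) (inside d))
        (≤-trans (inner-bound P) (tri-mono (bound small)))
      where
      -- `ν P` is at most `k − 1`, and `2(k − 1) + 1` is `k + k ∸ 1`.
      bound : ∀ {i j} → i < j → suc (i + i) ≤ j + j ∸ 1
      bound {i} {suc j} (s≤s i≤j) = ≤-trans (s≤s (+-mono-≤ i≤j i≤j)) (≤-reflexive (sym (+-suc j j)))

    mutual

      -- Now it is Mini who moves when the number of edges has the parity of `k`. `freeMove` relies
      -- on this; when Max's edge calls for an immediate reply, `answer` supplies the move.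
      maxTurn : ∀ f {G} → tri n < f + length G → Valid k G → Safe G → 2 ∣ suc (length G + k) → MiniForces k t Max G
      maxTurn zero b v _ _ = ⊥-elim (<⇒≱ b (Valid⇒length≤ v))
      maxTurn (suc f) {G} b v s odd with legalMove? k G
      ... | inj₂ T         = done T (Safe-bound v s)
      ... | inj₁ (e₀ , l₀) = maxMove (λ T → T e₀ l₀) λ e l →
        respond f (≤-trans b (≤-reflexive (sym (+-suc f _)))) (Valid-∷ v l) (answer v s l) odd

      respond : ∀ f {G e} → tri n < f + suc (length G) → Valid k (e ∷ G) → Answer G e → 2 ∣ suc (length G + k) →
                MiniForces k t Mini (e ∷ G)
      respond f b v (inj₁ s) even = miniTurn f b v s even
      respond f b v (inj₂ m) even = makeMove f b v m even

      miniTurn : ∀ f {G} → tri n < f + length G → Valid k G → Safe G → 2 ∣ length G + k → MiniForces k t Mini G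
      miniTurn f b v s even = makeMove f b v (freeMove v s even) even

      makeMove : ∀ f {G} → tri n < f + length G → Valid k G → FreeMove G → 2 ∣ length G + k → MiniForces k t Mini G
      makeMove zero b v _ _ = ⊥-elim (<⇒≱ b (Valid⇒length≤ v))
      makeMove (suc f) b v (e , l , s) even =
        miniMove e l (maxTurn f (≤-trans b (≤-reflexive (sym (+-suc f _)))) (Valid-∷ v l) s (2∣-suc₂ even))

    -- A single vertex is factor-critical, so the game starts from singletons with `ν` equal to
    -- zero.
    Safe-[] : 1 ≤ k → Safe []
    Safe-[] 1≤k = safe (decomposition (↭-reflexive (concat-map-[ allFin n ])) [] (singletons (allFin n)))
                       (≤-trans (s≤s (≤-reflexive (ν-singletons (allFin n)))) 1≤k)
      where
      singletons : ∀ xs → All (Part []) (map [_] xs)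
      singletons []       = []
      singletons (x ∷ xs) = inj₁ (fc (here refl) λ { (here refl) → [] , refl , [] }) ∷ singletons xs
      ν-singletons : ∀ xs → ν (map [_] xs) ≡ 0
      ν-singletons []       = refl
      ν-singletons (x ∷ xs) = ν-singletons xs

  -- Upper bounds for the score

  Mini-small : ∀ {k} p → 1 ≤ k → n < k + k → MiniForces {n} k (tri (k + k ∸ 1)) p []
  Mini-small {k} p 1≤k n<2k = MiniForces-any (λ _ → ⊤) (λ _ _ _ → tt)
    (λ v _ _ → ≤-trans (Valid⇒length≤ v) (tri-mono (pred n<2k))) p (Valid-[] 1≤k) tt
    where
    pred : ∀ {i j} → i < j → i ≤ j ∸ 1
    pred (s≤s q) = q

  tri≡bound : ∀ k → tri (k + k ∸ 1) ≡ (2 * k ∸ 1) C 2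
  tri≡bound k = trans (tri≡C (k + k ∸ 1)) (cong (λ z → (k + z ∸ 1) C 2) (sym (+-identityʳ k)))

  score≤-Max-first : ∀ {k} → 1 ≤ k → ¬ 2 ∣ k → ScoreAtMost n k Max ((2 * k ∸ 1) C 2)
  score≤-Max-first {k} 1≤k odd = subst (λ t → MiniForces k t Max []) (tri≡bound k) forces
    where
    forces : MiniForces {n} k (tri (k + k ∸ 1)) Max []
    forces with k + k ≤? n
    ... | no ¬p = Mini-small Max 1≤k (≰⇒> ¬p)
    ... | yes p = MiniStrategy.maxTurn k p (suc (tri n)) (s≤s (m≤m+n _ _)) (Valid-[] 1≤k)
                    (MiniStrategy.Safe-[] k p 1≤k) (¬2∣⇒2∣suc _ odd)

  score≤-Mini-first : ∀ {k} → 1 ≤ k → 2 ∣ k → ScoreAtMost n k Mini ((2 * k ∸ 1) C 2)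
  score≤-Mini-first {k} 1≤k even = subst (λ t → MiniForces k t Mini []) (tri≡bound k) forces
    where
    forces : MiniForces {n} k (tri (k + k ∸ 1)) Mini []
    forces with k + k ≤? n
    ... | no ¬p = Mini-small Mini 1≤k (≰⇒> ¬p)
    ... | yes p = MiniStrategy.miniTurn k p (suc (tri n)) (s≤s (m≤m+n _ _)) (Valid-[] 1≤k)
                    (MiniStrategy.Safe-[] k p 1≤k) even

theorem1p7 : (k : ℕ) → 2 ≤ k → (n : ℕ) →
    ((2 ∣ k → ScoreAtLeast n k Max (n ∸ 1))
    × (¬ (2 ∣ k) → ScoreAtLeast n k Mini (n ∸ 1))
    × (¬ (2 ∣ k) → ScoreAtMost n k Max ((2 * k ∸ 1) C 2))
    × (2 ∣ k → ScoreAtMost n k Mini ((2 * k ∸ 1) C 2)))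
theorem1p7 k 2≤k n =
  score≥-Max-first 2≤k , score≥-Mini-first 2≤k , score≤-Max-first (<⇒≤ 2≤k) , score≤-Mini-first (<⇒≤ 2≤k)
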